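{- Let $(a,b)$ be a multiplicatively dependent pair of integers with $1<a<b$. Then for any integers $\varepsilon,\delta$ with $0<|\varepsilon|<\frac14\sqrt{a}$ and $0<|\delta|<\frac14\sqrt{b}$, the pair $(a+\varepsilon,b+\delta)$ is multiplicatively independent.
   Context: An $n$-tuple $(z_1,\ldots,z_n)\in\mathbb{C}^n$ is called multiplicatively dependent if there exists a non-zero integer vector $(k_1,\ldots,k_n)\in\mathbb{Z}^n$ such that $z_1^{k_1}\cdots z_n^{k_n}=1$; otherwise it is called multiplicatively independent. -}

module Defs where

open import Data.Nat using (ℕ; zero; suc)
open import Data.Integer as ℤ using (ℤ; +_; -[1+_]; +[1+_])
open import Data.Rational using (ℚ; mkℚ; 0ℚ; 1ℚ; _*_; 1/_; _/_)
open import Data.Product using (Σ; _×_; _,_)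
open import Relation.Binary.PropositionalEquality using (_≡_)
open import Relation.Nullary using (¬_)

_^ℕ_ : ℚ → ℕ → ℚ
p ^ℕ zero  = 1ℚ
p ^ℕ suc n = p * (p ^ℕ n)

-- multiplicative inverse in ℚ (with the convention 0⁻¹ = 0; never used
-- on zero in the theorem below, since all entries are nonzero there)
inv : ℚ → ℚ
inv p@(mkℚ (+ zero) _ _) = 0ℚ
inv p@(mkℚ +[1+ n ] _ _) = 1/ p
inv p@(mkℚ -[1+ n ] _ _) = 1/ p

_^ᶻ_ : ℚ → ℤ → ℚ
p ^ᶻ (+ n)     = p ^ℕ n
p ^ᶻ -[1+ n ]  = inv (p ^ℕ suc n)

ι : ℤ → ℚ
ι z = z / 1

MultDep₂ : ℤ → ℤ → Set
MultDep₂ z₁ z₂ =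
  Σ ℤ λ k₁ → Σ ℤ λ k₂ →
    ¬ (k₁ ≡ + 0 × k₂ ≡ + 0) × (((ι z₁) ^ᶻ k₁) * ((ι z₂) ^ᶻ k₂) ≡ 1ℚ)

MultIndep₂ : ℤ → ℤ → Set
MultIndep₂ z₁ z₂ = ¬ MultDep₂ z₁ z₂

{-# OPTIONS --safe #-}
-- Proof idea.  Let X > Y be the two numbers a, a+ε and U, V the corresponding
-- numbers among b, b+δ, and put η = X - Y.  If both pairs are dependent, then
-- X = eᵅ, U = eᵘ, Y = fᵝ, V = fʷ.  The divided differences of x^N at p copies
-- of X and q copies of Y give Hermite–Padé relations
--   η^(p+q-1) E = P X^H ± Q Y^L
-- with small positive E and Q.  Comparing Y^L with V and V with U makes X^H
-- divide a combination of η^(p+q-1) E and Q|U - V|; choosing the parity of p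
-- makes it a sum of positive terms, and 16η² < X together with 16(U - V)² < U ⊔ V
-- makes this sum smaller than X^H once H = ⌊u/α⌋ is moderately large.  If H is
-- small, then either X is bounded, and a direct computation settles the case,
-- or (X/Y)ᵘ is too close to 1 to reach f, which it has to exceed approximately.

module Submission where

open import Defs

-- With `p` and `q` both near `ρH`, the first error term is small enough once
-- `2 ^ (H + 1) * φ′ ≤ 8 ^ q`, since the condition on it then becomes `(16η²) ^ q < (X + η) ^ q`;
-- this asks for `ρ` slightly above 1/3. The second error term asks for
-- `(4X) ^ (2q) * φ′ ^ 2 ≤ X ^ H`, hence for `ρ` below 1/2 by a margin that shrinks as `X` grows.
-- The choice `ρ = 7/20` leaves only `X > 32` as `H` tends to infinity; the rounding terms then turn
-- `X ≥ 64` into `H ≥ 123` and `X ≥ 256` into `H ≥ 52`. This fails near `X = 17`. For `X < 65`,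
-- where `η = 1`, unequal numbers of copies of `X` and `Y` therefore remove the factor `φ′`; the
-- extreme case is 17 against 16. For small `H` the lever is that `wα` and `uβ` are integers: if
-- they differ, they differ by at least one, which yields a whole factor `e` or `f`. They cannot
-- coincide, because both fractions are in lowest terms and equal powers of distinct bases are far
-- apart.

module ClosePowers where

  open import Data.Bool using (Bool; true; false; if_then_else_; _∧_; T)
  open import Data.Empty using (⊥; ⊥-elim)
  open import Data.Nat
  open import Data.Nat.Coprimality using (Coprime; coprime-divisor)
  open import Data.Nat.Divisibility
  open import Data.Nat.DivMod using (_/_; _%_; m≡m%n+[m/n]*n; m%n<n; m/n*n≤m)
  open import Data.Nat.Properties
  open import Data.Nat.Tactic.RingSolver using (solve-∀)
  open import Data.Product using (∃; ∃₂; _,_; _×_; proj₁; proj₂)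
  open import Data.Sum using (_⊎_; inj₁; inj₂; [_,_]′)
  open import Data.Unit using (tt)
  open import Relation.Binary.Definitions using (tri<; tri≈; tri>)
  open import Relation.Binary.PropositionalEquality
  open import Relation.Nullary using (¬_; yes; no)

  -- Hermite–Padé approximation

  ^-distribʳ-* : ∀ n x y → (x * y) ^ n ≡ x ^ n * y ^ n
  ^-distribʳ-* zero    x y = refl
  ^-distribʳ-* (suc n) x y = trans (cong (x * y *_) (^-distribʳ-* n x y)) (l x y (x ^ n) (y ^ n))
    where
    l : ∀ x y a b → x * y * (a * b) ≡ x * a * (y * b)
    l = solve-∀

  ^-cancelʳ-≤ : ∀ n .{{_ : NonZero n}} {x y} → x ^ n ≤ y ^ n → x ≤ y
  ^-cancelʳ-≤ n le = ≮⇒≥ λ y<x → <⇒≱ (^-monoˡ-< n y<x) le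

  -- SignedCong c p m n  says  m ≡ (-1)ᵖ n  (mod c).
  SignedCong : ℕ → ℕ → ℕ → ℕ → Set
  SignedCong c zero          m n = ∃₂ λ i j → m + i * c ≡ n + j * c
  SignedCong c (suc zero)    m n = ∃₂ λ i j → m + n + i * c ≡ j * c
  SignedCong c (suc (suc p)) m n = SignedCong c p m n

  -- Going from `p` to `p + 1` flips the sign, so in the difference `m₁ - m₂` the terms `n₁` and
  -- `n₂` get the same sign and add up; nothing cancels, and natural numbers suffice.
  signedCong-sub : ∀ p {c m m₁ m₂ n₁ n₂} → m + m₂ ≡ m₁ →
    SignedCong c (suc p) m₁ n₁ → SignedCong c p m₂ n₂ → SignedCong c (suc p) m (n₁ + n₂)
  signedCong-sub zero {c} {m} {m₁} {m₂} {n₁} {n₂} eq (i₁ , j₁ , e₁) (i₂ , j₂ , e₂) =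
    i₁ + j₂ , j₁ + i₂ , (begin
      m + (n₁ + n₂) + (i₁ + j₂) * c    ≡⟨ l₁ m n₁ n₂ i₁ j₂ c ⟩
      m + n₁ + i₁ * c + (n₂ + j₂ * c)  ≡⟨ cong (m + n₁ + i₁ * c +_) (sym e₂) ⟩
      m + n₁ + i₁ * c + (m₂ + i₂ * c)  ≡⟨ l₂ m n₁ m₂ i₁ i₂ c ⟩
      (m + m₂) + n₁ + i₁ * c + i₂ * c  ≡⟨ cong (λ x → x + n₁ + i₁ * c + i₂ * c) eq ⟩
      m₁ + n₁ + i₁ * c + i₂ * c        ≡⟨ cong (_+ i₂ * c) e₁ ⟩
      j₁ * c + i₂ * c                  ≡⟨ sym (*-distribʳ-+ c j₁ i₂) ⟩
      (j₁ + i₂) * c                    ∎)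
    where
    open ≡-Reasoning
    l₁ : ∀ m n₁ n₂ i₁ j₂ c → m + (n₁ + n₂) + (i₁ + j₂) * c ≡ m + n₁ + i₁ * c + (n₂ + j₂ * c)
    l₁ = solve-∀
    l₂ : ∀ m n₁ m₂ i₁ i₂ c → m + n₁ + i₁ * c + (m₂ + i₂ * c) ≡ (m + m₂) + n₁ + i₁ * c + i₂ * c
    l₂ = solve-∀
  signedCong-sub (suc zero) {c} {m} {m₁} {m₂} {n₁} {n₂} eq (i₁ , j₁ , e₁) (i₂ , j₂ , e₂) =
    i₁ + j₂ , j₁ + i₂ , (begin
      m + (i₁ + j₂) * c                ≡⟨ l₁ m i₁ j₂ c ⟩
      m + i₁ * c + j₂ * c              ≡⟨ cong (m + i₁ * c +_) (sym e₂) ⟩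
      m + i₁ * c + (m₂ + n₂ + i₂ * c)  ≡⟨ l₂ m m₂ n₂ i₁ i₂ c ⟩
      (m + m₂) + i₁ * c + (n₂ + i₂ * c) ≡⟨ cong (λ x → x + i₁ * c + (n₂ + i₂ * c)) eq ⟩
      m₁ + i₁ * c + (n₂ + i₂ * c)      ≡⟨ cong (_+ (n₂ + i₂ * c)) e₁ ⟩
      n₁ + j₁ * c + (n₂ + i₂ * c)      ≡⟨ l₃ n₁ n₂ j₁ i₂ c ⟩
      n₁ + n₂ + (j₁ + i₂) * c          ∎)
    where
    open ≡-Reasoning
    l₁ : ∀ m i₁ j₂ c → m + (i₁ + j₂) * c ≡ m + i₁ * c + j₂ * c
    l₁ = solve-∀
    l₂ : ∀ m m₂ n₂ i₁ i₂ c → m + i₁ * c + (m₂ + n₂ + i₂ * c) ≡ (m + m₂) + i₁ * c + (n₂ + i₂ * c)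
    l₂ = solve-∀
    l₃ : ∀ n₁ n₂ j₁ i₂ c → n₁ + j₁ * c + (n₂ + i₂ * c) ≡ n₁ + n₂ + (j₁ + i₂) * c
    l₃ = solve-∀
  signedCong-sub (suc (suc p)) eq r s = signedCong-sub p eq r s

  signedCong-weaken : ∀ p {c d m n} → SignedCong (d * c) p m n → SignedCong c p m n
  signedCong-weaken zero {c} {d} {m} {n} (i , j , e) = i * d , j * d ,
    trans (cong (m +_) (*-assoc i d c)) (trans e (cong (n +_) (sym (*-assoc j d c))))
  signedCong-weaken (suc zero) {c} {d} {m} {n} (i , j , e) = i * d , j * d ,
    trans (cong (m + n +_) (*-assoc i d c)) (trans e (sym (*-assoc j d c)))
  signedCong-weaken (suc (suc p)) {d = d} r = signedCong-weaken p {d = d} r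

  ∣⇒signedCong : ∀ p {c m} → c ∣ m → SignedCong c p m 0
  ∣⇒signedCong zero          {c} {m} (divides k eq) = 0 , k , trans (+-identityʳ m) eq
  ∣⇒signedCong (suc zero)    {c} {m} (divides k eq) =
    0 , k , trans (+-identityʳ (m + 0)) (trans (+-identityʳ m) eq)
  ∣⇒signedCong (suc (suc p)) d = ∣⇒signedCong p d

  module Approximants (Y η : ℕ) where

    X : ℕ
    X = Y + η

    -- h p q K is the complete homogeneous symmetric polynomial of degree K in
    -- p copies of X and q copies of Y: the divided difference of x^(K+p+q-1).
    h : ℕ → ℕ → ℕ → ℕ
    h p       q       zero    = 1
    h zero    zero    (suc K) = 0
    h zero    (suc q) (suc K) = Y * h zero (suc q) K + h zero q (suc K)
    h (suc p) q       (suc K) = X * h (suc p) q K + h p q (suc K)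

    -- The definition of `h` peels off copies of `X` first; by symmetry in the variables a copy of
    -- `Y` may be peeled off instead.
    h-Y : ∀ p q K → h p (suc q) (suc K) ≡ Y * h p (suc q) K + h p q (suc K)
    h-Y zero    q K    = refl
    h-Y (suc p) q zero = trans (cong (X * 1 +_) (h-Y p q zero)) (l X Y (h p q 1))
      where
      l : ∀ X Y z → X * 1 + (Y * 1 + z) ≡ Y * 1 + (X * 1 + z)
      l = solve-∀
    h-Y (suc p) q (suc K) =
      trans (cong₂ (λ a b → X * a + b) (h-Y (suc p) q K) (h-Y p q (suc K)))
            (l X Y (h (suc p) (suc q) K) (h p (suc q) (suc K)) (h (suc p) q (suc K)) (h p q (suc (suc K))))
      where
      l : ∀ X Y a b c d → X * (Y * a + c) + (Y * b + d) ≡ Y * (X * a + b) + (X * c + d)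
      l = solve-∀

    -- Equating the two ways to peel `h (suc p) (suc q) (suc K)`, by `X` and by `Y`, gives the
    -- recursion of divided differences with denominator `η = X - Y`.
    h-η : ∀ p q K → η * h (suc p) (suc q) K + h p (suc q) (suc K) ≡ h (suc p) q (suc K)
    h-η p q K = +-cancelˡ-≡ (Y * h (suc p) (suc q) K) _ _
      (trans (l Y η (h (suc p) (suc q) K) (h p (suc q) (suc K))) (h-Y (suc p) q K))
      where
      l : ∀ Y η a b → Y * a + (η * a + b) ≡ (Y + η) * a + b
      l = solve-∀

    Y^K∣h : ∀ q K → Y ^ K ∣ h 0 q K
    Y^K∣h q       zero    = ∣-refl
    Y^K∣h zero    (suc K) = (Y * Y ^ K) ∣0
    Y^K∣h (suc q) (suc K) = ∣m∣n⇒∣m+n (*-monoʳ-∣ Y (Y^K∣h (suc q) K)) (Y^K∣h q (suc K))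

    X^K∣h : ∀ p K → X ^ K ∣ h p 0 K
    X^K∣h p       zero    = ∣-refl
    X^K∣h zero    (suc K) = (X * X ^ K) ∣0
    X^K∣h (suc p) (suc K) = ∣m∣n⇒∣m+n (*-monoʳ-∣ X (X^K∣h (suc p) K)) (X^K∣h p (suc K))

    h>0 : ∀ .{{_ : NonZero Y}} p q K → 1 ≤ h (suc p) q K
    h>0 p q zero    = s≤s z≤n
    h>0 p q (suc K) = ≤-trans (*-mono-≤ (≤-trans (>-nonZero⁻¹ Y) (m≤m+n Y η)) (h>0 p q K))
                              (m≤m+n (X * h (suc p) q K) (h p q (suc K)))

    -- The power of `η` clears the denominators of the divided difference, so that all coefficients
    -- in `G-rec` are 1.
    G : ℕ → ℕ → ℕ → ℕ
    G p q K = η ^ pred (p + q) * h p q K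

    G-rec : ∀ p q K → G (suc p) (suc q) K + G p (suc q) (suc K) ≡ G (suc p) q (suc K)
    G-rec p q K = begin
      η ^ (p + suc q) * h (suc p) (suc q) K + η ^ pred (p + suc q) * h p (suc q) (suc K)
        ≡⟨ cong (λ x → η ^ x * h (suc p) (suc q) K + η ^ pred x * h p (suc q) (suc K)) (+-suc p q) ⟩
      η * η ^ (p + q) * h (suc p) (suc q) K + η ^ (p + q) * h p (suc q) (suc K)
        ≡⟨ l η (η ^ (p + q)) (h (suc p) (suc q) K) (h p (suc q) (suc K)) ⟩
      η ^ (p + q) * (η * h (suc p) (suc q) K + h p (suc q) (suc K))
        ≡⟨ cong (η ^ (p + q) *_) (h-η p q K) ⟩
      η ^ (p + q) * h (suc p) q (suc K) ∎
      where
      open ≡-Reasoning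
      l : ∀ η e a b → η * e * a + e * b ≡ e * (η * a + b)
      l = solve-∀

    -- Unrolling `G-rec` writes `G p q K` through boundary values `G p′ 0 _`, divisible by powers of
    -- `X`, and `G 0 q′ _`, divisible by powers of `Y`. Every lowering of `p` changes the sign, so
    -- the latter all carry the sign (-1)ᵖ; `W` is their sum without it.
    W : ℕ → ℕ → ℕ → ℕ
    W zero    q       K = G zero q K
    W (suc p) zero    K = 0
    W (suc p) (suc q) K = W (suc p) q (suc K) + W p (suc q) (suc K)

    -- The Hermite–Padé relation: G = P·X^(K+q) + (-1)ᵖ Q·Y^(K+p) with Q·Y^(K+p) = W.
    G≡±W : ∀ p q K → SignedCong (X ^ (K + q)) p (G p q K) (W p q K)
    G≡±W zero    q       K = 0 , 0 , refl
    G≡±W (suc p) zero    K = ∣⇒signedCong (suc p)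
      (subst (λ k → X ^ k ∣ G (suc p) 0 K) (sym (+-identityʳ K)) (∣n⇒∣m*n (η ^ (p + 0)) (X^K∣h (suc p) K)))
    G≡±W (suc p) (suc q) K = signedCong-sub p (G-rec p q K)
      (subst (λ k → SignedCong (X ^ k) (suc p) (G (suc p) q (suc K)) (W (suc p) q (suc K))) (sym (+-suc K q)) (G≡±W (suc p) q (suc K)))
      -- Lowering `p` raises `K`, so this branch is known modulo one power of `X` more than is
      -- required.
      (signedCong-weaken p {d = X} (G≡±W p (suc q) (suc K)))

    Y^[K+p]∣W : ∀ p q K → Y ^ (K + p) ∣ W p q K
    Y^[K+p]∣W zero q K = subst (λ k → Y ^ k ∣ G 0 q K) (sym (+-identityʳ K)) (∣n⇒∣m*n (η ^ pred q) (Y^K∣h q K))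
    Y^[K+p]∣W (suc p) zero    K = _ ∣0
    Y^[K+p]∣W (suc p) (suc q) K = ∣m∣n⇒∣m+n
      (∣-trans (∣n⇒∣m*n Y ∣-refl) (Y^[K+p]∣W (suc p) q (suc K)))
      (subst (λ k → Y ^ k ∣ W p (suc q) (suc K)) (sym (+-suc K p)) (Y^[K+p]∣W p (suc q) (suc K)))

    private
      2Y+η≡X+Y : ∀ Y η → 2 * Y + η ≡ (Y + η) + Y
      2Y+η≡X+Y = solve-∀

    -- `h 0 (suc q) K` is a binomial coefficient times `Y ^ K`, so the left side is a single term of
    -- the binomial expansion of `(2 * Y + η) ^ (K + q)`, and `2 * Y + η` is `X + Y`.
    2^K*G₀≤ : ∀ q K → 2 ^ K * (η ^ q * h 0 (suc q) K) ≤ (X + Y) ^ (K + q)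
    2^K*G₀≤ q zero = ≤-trans (≤-reflexive (l (η ^ q)))
        (^-monoˡ-≤ q (≤-trans (m≤n+m η Y) (m≤m+n X Y)))
      where
      l : ∀ a → 1 * (a * 1) ≡ a
      l = solve-∀
    2^K*G₀≤ zero (suc K) = ≤-trans (≤-reflexive (l Y (2 ^ K) (h 0 1 K)))
        (*-mono-≤ (≤-trans (≤-reflexive (l′ Y)) (+-monoˡ-≤ Y (m≤m+n Y η))) (2^K*G₀≤ zero K))
      where
      l : ∀ Y a b → 2 * a * (1 * (Y * b + 0)) ≡ 2 * Y * (a * (1 * b))
      l = solve-∀
      l′ : ∀ Y → 2 * Y ≡ Y + Y
      l′ = solve-∀
    2^K*G₀≤ (suc q) (suc K) = begin
      2 * 2 ^ K * (η * η ^ q * (Y * h 0 (suc (suc q)) K + h 0 (suc q) (suc K)))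
        ≡⟨ l Y η (2 ^ K) (η ^ q) (h 0 (suc (suc q)) K) (h 0 (suc q) (suc K)) ⟩
      2 * Y * (2 ^ K * (η * η ^ q * h 0 (suc (suc q)) K)) + η * (2 * 2 ^ K * (η ^ q * h 0 (suc q) (suc K)))
        ≤⟨ +-mono-≤ (*-monoʳ-≤ (2 * Y) (2^K*G₀≤ (suc q) K)) (*-monoʳ-≤ η (2^K*G₀≤ q (suc K))) ⟩
      2 * Y * (X + Y) ^ (K + suc q) + η * (X + Y) ^ suc (K + q)
        ≡⟨ cong (λ k → 2 * Y * (X + Y) ^ (K + suc q) + η * (X + Y) ^ k) (sym (+-suc K q)) ⟩
      2 * Y * (X + Y) ^ (K + suc q) + η * (X + Y) ^ (K + suc q)
        ≡⟨ sym (*-distribʳ-+ ((X + Y) ^ (K + suc q)) (2 * Y) η) ⟩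
      (2 * Y + η) * (X + Y) ^ (K + suc q)
        ≡⟨ cong (_* (X + Y) ^ (K + suc q)) (2Y+η≡X+Y Y η) ⟩
      (X + Y) * (X + Y) ^ (K + suc q) ∎
      where
      open ≤-Reasoning
      l : ∀ Y η t e a b → 2 * t * (η * e * (Y * a + b)) ≡ 2 * Y * (t * (η * e * a)) + η * (2 * t * (e * b))
      l = solve-∀

    -- Each step of the recursion for `W` raises `K` by one and adds two terms; the factor `2 ^ K`
    -- pays for this doubling, while the exponent on the right does not change.
    2^K*W≤ : ∀ p q K → 2 ^ K * W p q K ≤ (X + Y) ^ (K + pred (p + q))
    2^K*W≤ zero    zero    zero    = ≤-refl
    2^K*W≤ zero    zero    (suc K) = ≤-trans (≤-reflexive (*-zeroʳ (2 ^ suc K))) z≤n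
    2^K*W≤ zero    (suc q) K       = 2^K*G₀≤ q K
    2^K*W≤ (suc p) zero    K       = ≤-trans (≤-reflexive (*-zeroʳ (2 ^ K))) z≤n
    2^K*W≤ (suc p) (suc q) K       = *-cancelˡ-≤ 2 (begin
      2 * (2 ^ K * (W (suc p) q (suc K) + W p (suc q) (suc K)))
        ≡⟨ l (2 ^ K) (W (suc p) q (suc K)) (W p (suc q) (suc K)) ⟩
      2 ^ suc K * W (suc p) q (suc K) + 2 ^ suc K * W p (suc q) (suc K)
        ≤⟨ +-mono-≤ (2^K*W≤ (suc p) q (suc K)) (2^K*W≤ p (suc q) (suc K)) ⟩
      (X + Y) ^ (suc K + (p + q)) + (X + Y) ^ (suc K + pred (p + suc q))
        ≡⟨ cong₂ (λ a b → (X + Y) ^ a + (X + Y) ^ b) e₁ e₂ ⟩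
      (X + Y) ^ (K + (p + suc q)) + (X + Y) ^ (K + (p + suc q))
        ≡⟨ l′ ((X + Y) ^ (K + (p + suc q))) ⟩
      2 * (X + Y) ^ (K + (p + suc q)) ∎)
      where
      open ≤-Reasoning
      l : ∀ t a b → 2 * (t * (a + b)) ≡ 2 * t * a + 2 * t * b
      l = solve-∀
      l′ : ∀ a → a + a ≡ 2 * a
      l′ = solve-∀
      e₁ : suc K + (p + q) ≡ K + (p + suc q)
      e₁ = trans (sym (+-suc K (p + q))) (cong (K +_) (sym (+-suc p q)))
      e₂ : suc K + pred (p + suc q) ≡ K + (p + suc q)
      e₂ = trans (cong (λ x → suc K + pred x) (+-suc p q)) e₁

    private
      η≤X : η ≤ X
      η≤X = m≤n+m η Y
      X+η≤2X : X + η ≤ 2 * X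
      X+η≤2X = ≤-trans (+-monoʳ-≤ X η≤X) (≤-reflexive (l X))
        where
        l : ∀ X → X + X ≡ 2 * X
        l = solve-∀

    -- A coefficient is bounded by a value of the generating function, here at t = 1/(2X), where
    -- each copy of `Y` contributes 1/(1 - Yt) = 2X/(X + η). The factor 2 of the single copy of `X`
    -- is saved.
    h₁≤ : ∀ q K → h 1 q K * (X + η) ^ q ≤ (2 * X) ^ (K + q)
    h₁≤ q zero = ≤-trans (≤-reflexive (*-identityˡ _)) (^-monoˡ-≤ q X+η≤2X)
    h₁≤ zero (suc K) = ≤-trans (≤-reflexive (l X (h 1 0 K)))
        (*-mono-≤ (m≤m+n X (X + 0)) (h₁≤ zero K))
      where
      l : ∀ X a → (X * a + 0) * 1 ≡ X * (a * 1)
      l = solve-∀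
    h₁≤ (suc q) (suc K) = begin
      h 1 (suc q) (suc K) * ((X + η) * (X + η) ^ q)
        ≡⟨ cong (_* ((X + η) * (X + η) ^ q)) (h-Y 1 q K) ⟩
      (Y * h 1 (suc q) K + h 1 q (suc K)) * ((X + η) * (X + η) ^ q)
        ≡⟨ l Y (h 1 (suc q) K) (h 1 q (suc K)) (X + η) ((X + η) ^ q) ⟩
      Y * (h 1 (suc q) K * ((X + η) * (X + η) ^ q)) + (X + η) * (h 1 q (suc K) * (X + η) ^ q)
        ≤⟨ +-mono-≤ (*-monoʳ-≤ Y (h₁≤ (suc q) K)) (*-monoʳ-≤ (X + η) (h₁≤ q (suc K))) ⟩
      Y * (2 * X) ^ (K + suc q) + (X + η) * (2 * X) ^ suc (K + q)
        ≡⟨ cong (λ k → Y * (2 * X) ^ (K + suc q) + (X + η) * (2 * X) ^ k) (sym (+-suc K q)) ⟩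
      Y * (2 * X) ^ (K + suc q) + (X + η) * (2 * X) ^ (K + suc q)
        ≡⟨ l′ Y η ((2 * X) ^ (K + suc q)) ⟩
      2 * X * (2 * X) ^ (K + suc q) ∎
      where
      open ≤-Reasoning
      l : ∀ Y a b t s → (Y * a + b) * (t * s) ≡ Y * (a * (t * s)) + t * (b * s)
      l = solve-∀
      l′ : ∀ Y η s → Y * s + (Y + η + η) * s ≡ 2 * (Y + η) * s
      l′ = solve-∀

    -- At the same t = 1/(2X), every further copy of `X` contributes 1/(1 - Xt) = 2.
    h≤ : ∀ p q K → h (suc p) q K * (X ^ p * (X + η) ^ q) ≤ (2 * X) ^ (K + (p + q))
    h≤ zero q K = ≤-trans (≤-reflexive (cong (h 1 q K *_) (*-identityˡ _))) (h₁≤ q K)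
    h≤ (suc p) q zero = begin
      1 * (X ^ suc p * (X + η) ^ q)    ≡⟨ *-identityˡ _ ⟩
      X ^ suc p * (X + η) ^ q          ≤⟨ *-mono-≤ (^-monoˡ-≤ (suc p) (m≤m+n X (X + 0))) (^-monoˡ-≤ q X+η≤2X) ⟩
      (2 * X) ^ suc p * (2 * X) ^ q    ≡⟨ sym (^-distribˡ-+-* (2 * X) (suc p) q) ⟩
      (2 * X) ^ (suc p + q)            ∎
      where open ≤-Reasoning
    h≤ (suc p) q (suc K) = begin
      (X * h (suc (suc p)) q K + h (suc p) q (suc K)) * (X * X ^ p * (X + η) ^ q)
        ≡⟨ l X (h (suc (suc p)) q K) (h (suc p) q (suc K)) (X ^ p) ((X + η) ^ q) ⟩
      X * (h (suc (suc p)) q K * (X * X ^ p * (X + η) ^ q)) + X * (h (suc p) q (suc K) * (X ^ p * (X + η) ^ q))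
        ≤⟨ +-mono-≤ (*-monoʳ-≤ X (h≤ (suc p) q K)) (*-monoʳ-≤ X (h≤ p q (suc K))) ⟩
      X * (2 * X) ^ (K + suc (p + q)) + X * (2 * X) ^ (suc K + (p + q))
        ≡⟨ cong (λ k → X * (2 * X) ^ (K + suc (p + q)) + X * (2 * X) ^ k) (sym (+-suc K (p + q))) ⟩
      X * (2 * X) ^ (K + suc (p + q)) + X * (2 * X) ^ (K + suc (p + q))
        ≡⟨ l′ X ((2 * X) ^ (K + suc (p + q))) ⟩
      2 * X * (2 * X) ^ (K + suc (p + q)) ∎
      where
      open ≤-Reasoning
      l : ∀ X a b s t → (X * a + b) * (X * s * t) ≡ X * (a * (X * s * t)) + X * (b * (s * t))
      l = solve-∀
      l′ : ∀ X s → X * s + X * s ≡ 2 * X * s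
      l′ = solve-∀

    -- With the parity of p chosen so that the two error terms have the same
    -- sign, X^(K+q) divides the positive number φ′G + Qφδ.
    data Offset (U V δ p : ℕ) : Set where
      above : U ≡ V + δ → (∀ {c m n} → SignedCong c p m n → SignedCong c 0 m n) → Offset U V δ p
      below : V ≡ U + δ → (∀ {c m n} → SignedCong c p m n → SignedCong c 1 m n) → Offset U V δ p

    -- The fraction `φ′ / φ` is `V / Y ^ (K + p)`. In all applications one of `φ` and `φ′` is 1,
    -- depending on which of the two powers of `f` is larger.
    module _ (p q K φ′ : ℕ) {U V φ δ : ℕ} (Y^L : V * φ ≡ Y ^ (K + p) * φ′)
             (X^H∣U : X ^ (K + q) ∣ U) (off : Offset U V δ p) where

      private
        c = X ^ (K + q)
        Q = quotient (Y^[K+p]∣W p q K)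

        φ′W : φ′ * W p q K ≡ Q * φ * V
        φ′W = begin
          φ′ * W p q K               ≡⟨ cong (φ′ *_) (_∣_.equality (Y^[K+p]∣W p q K)) ⟩
          φ′ * (Q * Y ^ (K + p))     ≡⟨ l φ′ Q (Y ^ (K + p)) ⟩
          Q * (Y ^ (K + p) * φ′)     ≡⟨ cong (Q *_) (sym Y^L) ⟩
          Q * (V * φ)                ≡⟨ l′ Q V φ ⟩
          Q * φ * V                  ∎
          where
          open ≡-Reasoning
          l : ∀ a b c → a * (b * c) ≡ b * (c * a)
          l = solve-∀
          l′ : ∀ a b c → a * (b * c) ≡ a * c * b
          l′ = solve-∀

      c∣error : c ∣ φ′ * G p q K + Q * φ * δ
      c∣error = go X^H∣U off
       where
       go : X ^ (K + q) ∣ U → Offset U V δ p → c ∣ φ′ * G p q K + Q * φ * δ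
       go (divides k U≡kc) (above U≡V+δ sgn) with sgn (G≡±W p q K)
       ... | i , j , e = ∣m+n∣m⇒∣n (divides (φ′ * j + Q * φ * k) (begin
        φ′ * i * c + (φ′ * G p q K + Q * φ * δ)      ≡⟨ l φ′ i c (G p q K) (Q * φ * δ) ⟩
        φ′ * (G p q K + i * c) + Q * φ * δ           ≡⟨ cong (λ x → φ′ * x + Q * φ * δ) e ⟩
        φ′ * (W p q K + j * c) + Q * φ * δ           ≡⟨ l₂ φ′ (W p q K) j c (Q * φ * δ) ⟩
        φ′ * W p q K + Q * φ * δ + φ′ * j * c        ≡⟨ cong (λ x → x + Q * φ * δ + φ′ * j * c) φ′W ⟩
        Q * φ * V + Q * φ * δ + φ′ * j * c           ≡⟨ cong (_+ φ′ * j * c) (sym (*-distribˡ-+ (Q * φ) V δ)) ⟩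
        Q * φ * (V + δ) + φ′ * j * c                 ≡⟨ cong (λ x → Q * φ * x + φ′ * j * c) (trans (sym U≡V+δ) U≡kc) ⟩
        Q * φ * (k * c) + φ′ * j * c                 ≡⟨ l₃ (Q * φ) k c (φ′ * j) ⟩
        (φ′ * j + Q * φ * k) * c                     ∎))
        (divides (φ′ * i) refl)
        where
        open ≡-Reasoning
        l : ∀ φ′ i c g s → φ′ * i * c + (φ′ * g + s) ≡ φ′ * (g + i * c) + s
        l = solve-∀
        l₂ : ∀ φ′ w j c s → φ′ * (w + j * c) + s ≡ φ′ * w + s + φ′ * j * c
        l₂ = solve-∀
        l₃ : ∀ a k c b → a * (k * c) + b * c ≡ (b + a * k) * c
        l₃ = solve-∀
       go (divides k U≡kc) (below V≡U+δ sgn) with sgn (G≡±W p q K)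
       ... | i , j , e = ∣m+n∣m⇒∣n (divides (φ′ * j) (begin
        (φ′ * i + Q * φ * k) * c + (φ′ * G p q K + Q * φ * δ)  ≡⟨ l φ′ i c (G p q K) (Q * φ) k δ ⟩
        φ′ * G p q K + Q * φ * (k * c + δ) + φ′ * i * c        ≡⟨ cong (λ x → φ′ * G p q K + Q * φ * x + φ′ * i * c) (sym (trans V≡U+δ (cong (_+ δ) U≡kc))) ⟩
        φ′ * G p q K + Q * φ * V + φ′ * i * c                  ≡⟨ cong (λ x → φ′ * G p q K + x + φ′ * i * c) (sym φ′W) ⟩
        φ′ * G p q K + φ′ * W p q K + φ′ * i * c               ≡⟨ l₂ φ′ (G p q K) (W p q K) i c ⟩
        φ′ * (G p q K + W p q K + i * c)                       ≡⟨ cong (φ′ *_) e ⟩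
        φ′ * (j * c)                                           ≡⟨ sym (*-assoc φ′ j c) ⟩
        φ′ * j * c                                             ∎))
        (divides (φ′ * i + Q * φ * k) refl)
        where
        open ≡-Reasoning
        l : ∀ φ′ i c g s k δ → (φ′ * i + s * k) * c + (φ′ * g + s * δ) ≡ φ′ * g + s * (k * c + δ) + φ′ * i * c
        l = solve-∀
        l₂ : ∀ φ′ g w i c → φ′ * g + φ′ * w + φ′ * i * c ≡ φ′ * (g + w + i * c)
        l₂ = solve-∀

      Qφδ-small : .{{_ : NonZero V}} → 2 * (φ′ * W p q K * δ) < c * V → 2 * (Q * φ * δ) < c
      Qφδ-small b = *-cancelʳ-< V _ _ (≤-trans (s≤s (≤-reflexive (begin
        2 * (Q * φ * δ) * V        ≡⟨ l (Q * φ) δ V ⟩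
        2 * (Q * φ * V * δ)        ≡⟨ cong (λ x → 2 * (x * δ)) (sym φ′W) ⟩
        2 * (φ′ * W p q K * δ)     ∎))) b)
        where
        open ≡-Reasoning
        l : ∀ a δ V → 2 * (a * δ) * V ≡ 2 * (a * V * δ)
        l = solve-∀

    -- A positive multiple of `X ^ (K + q)` would be smaller than `X ^ (K + q)`. Positivity comes
    -- from `G`; the first inequality puts `φ′G` below half of that power through `h≤`, the second
    -- does the same for `Qφδ` through `2^K*W≤`.
    approximation-contradiction :
      .{{_ : NonZero Y}} → .{{_ : NonZero η}} →
      ∀ p q K {U V φ φ′ δ} → .{{_ : NonZero V}} → .{{_ : NonZero φ′}} →
      V * φ ≡ Y ^ (K + suc p) * φ′ → X ^ (K + q) ∣ U → Offset U V δ (suc p) →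
      2 * φ′ * η ^ (p + q) * 2 ^ (K + (p + q)) < (X + η) ^ q →
      2 * φ′ * δ * (X + Y) ^ (K + (p + q)) < 2 ^ K * X ^ (K + q) * V →
      ⊥
    approximation-contradiction p q K {U} {V} {φ} {φ′} {δ} eq dv off C₁ C₂ =
      <⇒≱ (*-cancelˡ-< 2 _ _ (begin-strict
        2 * (φ′ * G₀ + E)        ≡⟨ *-distribˡ-+ 2 (φ′ * G₀) E ⟩
        2 * (φ′ * G₀) + 2 * E    <⟨ +-mono-< G-small (Qφδ-small (suc p) q K φ′ eq dv off W-small) ⟩
        c + c                    ≡⟨ cong (c +_) (sym (+-identityʳ c)) ⟩
        2 * c                    ∎))
        (∣⇒≤ {{>-nonZero error>0}} (c∣error (suc p) q K φ′ eq dv off))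
      where
      open ≤-Reasoning
      instance
        _ : NonZero X
        _ = >-nonZero (≤-trans (>-nonZero⁻¹ Y) (m≤m+n Y η))
      instance
        X^p≢0 : NonZero (X ^ p)
        X^p≢0 = m^n≢0 X p
      instance
        X+η≢0 : NonZero ((X + η) ^ q)
        X+η≢0 = m^n≢0 (X + η) q {{>-nonZero (≤-trans (>-nonZero⁻¹ X) (m≤m+n X η))}}
      instance
        2^K≢0 : NonZero (2 ^ K)
        2^K≢0 = m^n≢0 2 K
      c  = X ^ (K + q)
      G₀ = G (suc p) q K
      E  = quotient (Y^[K+p]∣W (suc p) q K) * φ * δ
      error>0 : 0 < φ′ * G₀ + E
      error>0 = ≤-trans (*-mono-≤ (>-nonZero⁻¹ φ′)
        (*-mono-≤ (m^n>0 η (p + q)) (h>0 p q K))) (m≤m+n (φ′ * G₀) E)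
      G-small : 2 * (φ′ * G₀) < c
      G-small = *-cancelʳ-< (X ^ p * (X + η) ^ q) _ _ (begin-strict
        2 * (φ′ * (η ^ (p + q) * h (suc p) q K)) * (X ^ p * (X + η) ^ q)
          ≡⟨ l φ′ (η ^ (p + q)) (h (suc p) q K) (X ^ p * (X + η) ^ q) ⟩
        2 * φ′ * η ^ (p + q) * (h (suc p) q K * (X ^ p * (X + η) ^ q))
          ≤⟨ *-monoʳ-≤ (2 * φ′ * η ^ (p + q)) (h≤ p q K) ⟩
        2 * φ′ * η ^ (p + q) * (2 * X) ^ (K + (p + q))
          ≡⟨ cong (2 * φ′ * η ^ (p + q) *_) (^-distribʳ-* (K + (p + q)) 2 X) ⟩
        2 * φ′ * η ^ (p + q) * (2 ^ (K + (p + q)) * X ^ (K + (p + q)))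
          ≡⟨ sym (*-assoc (2 * φ′ * η ^ (p + q)) _ _) ⟩
        2 * φ′ * η ^ (p + q) * 2 ^ (K + (p + q)) * X ^ (K + (p + q))
          <⟨ *-monoˡ-< (X ^ (K + (p + q))) {{m^n≢0 X (K + (p + q))}} C₁ ⟩
        (X + η) ^ q * X ^ (K + (p + q))
          ≡⟨ cong (λ k → (X + η) ^ q * X ^ k) (l₂ K p q) ⟩
        (X + η) ^ q * X ^ (K + q + p)
          ≡⟨ cong ((X + η) ^ q *_) (^-distribˡ-+-* X (K + q) p) ⟩
        (X + η) ^ q * (c * X ^ p)
          ≡⟨ l₃ ((X + η) ^ q) c (X ^ p) ⟩
        c * (X ^ p * (X + η) ^ q) ∎)
        where
        l : ∀ a b c d → 2 * (a * (b * c)) * d ≡ 2 * a * b * (c * d)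
        l = solve-∀
        l₂ : ∀ K p q → K + (p + q) ≡ K + q + p
        l₂ = solve-∀
        l₃ : ∀ a b c → a * (b * c) ≡ b * (c * a)
        l₃ = solve-∀
      W-small : 2 * (φ′ * W (suc p) q K * δ) < c * V
      W-small = *-cancelˡ-< (2 ^ K) _ _ (begin-strict
        2 ^ K * (2 * (φ′ * W (suc p) q K * δ))     ≡⟨ l (2 ^ K) φ′ (W (suc p) q K) δ ⟩
        2 * φ′ * δ * (2 ^ K * W (suc p) q K)       ≤⟨ *-monoʳ-≤ (2 * φ′ * δ) (2^K*W≤ (suc p) q K) ⟩
        2 * φ′ * δ * (X + Y) ^ (K + (p + q))       <⟨ C₂ ⟩
        2 ^ K * c * V                              ≡⟨ *-assoc (2 ^ K) c V ⟩
        2 ^ K * (c * V)                            ∎)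
        where
        l : ∀ t a w δ → t * (2 * (a * w * δ)) ≡ 2 * a * δ * (t * w)
        l = solve-∀

  -- Finite verification

  -- One of the two differences vanishes; the other one carries the condition.
  Close : ℕ → ℕ → Set
  Close U V = 16 * ((V ∸ U) * (V ∸ U)) < V × 16 * ((U ∸ V) * (U ∸ V)) < U

  -- Always multiply the smaller of U and V: a number that is far from the smaller
  -- one stays far from it when it grows, so no pair of powers is missed.
  walk : ℕ → ℕ → ℕ → ℕ → ℕ → ℕ → Bool
  -- Running out of fuel counts as failure, so soundness needs no bound on the number of steps.
  walk zero       e f B U V = false
  walk (suc fuel) e f B U V =
    if B ≤ᵇ U then true
    else if U <ᵇ V then (V ≤ᵇ 16 * ((V ∸ U) * (V ∸ U))) ∧ walk fuel e f B (e * U) V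
    else (U ≤ᵇ 16 * ((U ∸ V) * (U ∸ V))) ∧ walk fuel e f B U (f * V)

  opaque
    -- Pairs that violate `Y < X` or the gap condition pass at once. The walk starts one step above
    -- `X` and `Y`, as only strictly higher powers occur as `U` and `V`. Opacity confines the
    -- evaluation of the search to the four checks.
    separated : ℕ → ℕ → ℕ → ℕ → ℕ → Bool
    separated H e f X Y =
      if X ≤ᵇ Y then true
      else if X ≤ᵇ 16 * ((X ∸ Y) * (X ∸ Y)) then true
      else walk 10000 e f (X ^ H) (e * X) (f * Y)

  T-∧ˡ : ∀ {a b} → T (a ∧ b) → T a
  T-∧ˡ {true} _ = tt

  T-∧ʳ : ∀ {a b} → T (a ∧ b) → T b
  T-∧ʳ {true} t = t

  T-if-≤ᵇ : ∀ {b} m n → n < m → T (if m ≤ᵇ n then true else b) → T b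
  T-if-≤ᵇ m n n<m t with m ≤ᵇ n in eq
  ... | true  = ⊥-elim (<⇒≱ n<m (≤ᵇ⇒≤ m n (subst T (sym eq) tt)))
  ... | false = t

  -- Enlarging `V` by `x` raises `16(V - U)²` by at least `16x²`, which is at least `x`.
  far-mono : ∀ U {V V′} → U ≤ V → V ≤ V′ → V ≤ 16 * ((V ∸ U) * (V ∸ U)) → V′ ≤ 16 * ((V′ ∸ U) * (V′ ∸ U))
  far-mono U {V} {V′} U≤V V≤V′ far = begin
    V′                                  ≡⟨ sym (m+[n∸m]≡n V≤V′) ⟩
    V + x                               ≤⟨ +-mono-≤ far (x≤16x² x) ⟩
    16 * (d * d) + 16 * (x * x)         ≤⟨ m≤m+n _ (32 * (d * x)) ⟩
    16 * (d * d) + 16 * (x * x) + 32 * (d * x) ≡⟨ l d x ⟩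
    16 * ((d + x) * (d + x))            ≡⟨ cong (λ y → 16 * (y * y)) d+x ⟩
    16 * ((V′ ∸ U) * (V′ ∸ U))          ∎
    where
    open ≤-Reasoning
    d = V ∸ U
    x = V′ ∸ V
    l : ∀ d x → 16 * (d * d) + 16 * (x * x) + 32 * (d * x) ≡ 16 * ((d + x) * (d + x))
    l = solve-∀
    x≤16x² : ∀ x → x ≤ 16 * (x * x)
    x≤16x² zero    = z≤n
    x≤16x² (suc x) = ≤-trans (m≤m*n (suc x) (suc x)) (m≤n*m (suc x * suc x) 16)
    d+x : d + x ≡ V′ ∸ U
    d+x = trans (+-comm d x) (trans (sym (+-∸-assoc x U≤V)) (cong (_∸ U) (trans (+-comm x V) (m+[n∸m]≡n V≤V′))))

  walk-sound : ∀ fuel e f B U V .{{_ : NonZero e}} .{{_ : NonZero f}} → T (walk fuel e f B U V) →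
    ∀ i j → e ^ i * U < B → ¬ Close (e ^ i * U) (f ^ j * V)
  walk-sound (suc fuel) e f B U V t i j lt with B ≤ᵇ U in eq
  ... | true = ⊥-elim (<⇒≱ lt (≤-trans (≤ᵇ⇒≤ B U (subst T (sym eq) tt)) (m≤n*m U (e ^ i) {{m^n≢0 e i}})))
  ... | false with U <ᵇ V in eq′
  ...   | true = go i lt
    where
    U<V = <ᵇ⇒< U V (subst T (sym eq′) tt)
    go : ∀ i → e ^ i * U < B → ¬ Close (e ^ i * U) (f ^ j * V)
    go zero _ (c , _) rewrite *-identityˡ U =
      <⇒≱ c (far-mono U (<⇒≤ U<V) (m≤n*m V (f ^ j) {{m^n≢0 f j}}) (≤ᵇ⇒≤ _ _ (T-∧ˡ t)))
    go (suc i) lt = subst (λ x → x < B → ¬ Close x (f ^ j * V)) (l e (e ^ i) U)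
        (walk-sound fuel e f B (e * U) V (T-∧ʳ {V ≤ᵇ 16 * ((V ∸ U) * (V ∸ U))} t) i j) lt
      where
      l : ∀ e a U → a * (e * U) ≡ e * a * U
      l = solve-∀
  ...   | false = go j
    where
    V≤U : V ≤ U
    V≤U = ≮⇒≥ λ U<V → subst T eq′ (<⇒<ᵇ U<V)
    go : ∀ j → ¬ Close (e ^ i * U) (f ^ j * V)
    go zero (_ , c) rewrite *-identityˡ V =
      <⇒≱ c (far-mono V V≤U (m≤n*m U (e ^ i) {{m^n≢0 e i}}) (≤ᵇ⇒≤ _ _ (T-∧ˡ t)))
    go (suc j) = subst (λ x → ¬ Close (e ^ i * U) x) (l f (f ^ j) V)
        (walk-sound fuel e f B U (f * V) (T-∧ʳ {U ≤ᵇ 16 * ((U ∸ V) * (U ∸ V))} t) i j lt)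
      where
      l : ∀ e a U → a * (e * U) ≡ e * a * U
      l = solve-∀

  opaque
    unfolding separated

    separated-sound : ∀ H e f X Y .{{_ : NonZero e}} .{{_ : NonZero f}} → T (separated H e f X Y) →
      Y < X → 16 * ((X ∸ Y) * (X ∸ Y)) < X →
      ∀ i j → e ^ i * (e * X) < X ^ H → ¬ Close (e ^ i * (e * X)) (f ^ j * (f * Y))
    separated-sound H e f X Y t Y<X gap =
      walk-sound 10000 e f (X ^ H) (e * X) (f * Y)
        (T-if-≤ᵇ X (16 * ((X ∸ Y) * (X ∸ Y))) gap (T-if-≤ᵇ X Y Y<X t))

  all< : ℕ → (ℕ → Bool) → Bool
  all< zero    P = true
  all< (suc n) P = P n ∧ all< n P

  all<-sound : ∀ n P → T (all< n P) → ∀ {i} → i < n → T (P i)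
  all<-sound (suc n) P t {i} i<1+n with i ≟ n
  ... | yes refl = T-∧ˡ t
  ... | no  i≢n  = all<-sound n P (T-∧ʳ {P n} t) (≤∧≢⇒< (s≤s⁻¹ i<1+n) i≢n)

  allPowers : ℕ → ℕ → ℕ → (ℕ → ℕ → Bool) → ℕ → Bool
  allPowersStep : ℕ → ℕ → ℕ → (ℕ → ℕ → Bool) → ℕ → ℕ → Bool
  allPowers zero       M k P x = false
  allPowers (suc fuel) M k P x = allPowersStep fuel M k P x (x ^ k)
  allPowersStep fuel M k P x y = if M ≤ᵇ y then true else P x y ∧ allPowers fuel M k P (suc x)

  allPowers-sound : ∀ fuel M k P x → T (allPowers fuel M k P x) → ∀ {y} → x ≤ y → y ^ k < M → T (P y (y ^ k))
  allPowers-sound (suc fuel) M k P x t {y} x≤y y^k<M with x ≟ y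
  ... | yes refl = T-∧ˡ (T-if-≤ᵇ M (x ^ k) y^k<M t)
  ... | no  x≢y  = allPowers-sound fuel M k P (suc x)
    (T-∧ʳ {P x (x ^ k)} (T-if-≤ᵇ M (x ^ k) (≤-<-trans (^-monoˡ-≤ k x≤y) y^k<M) t)) (≤∧≢⇒< x≤y x≢y) y^k<M

  -- From these values of H on, the approximation argument excludes X.
  bound : ℕ → ℕ
  -- The value 52 is the first `H` with `30H + 186 ≤ 8(6H - 92)`, and 123 the first with
  -- `30H + 186 ≤ 6(6H - 92)`; 900 is a round number above the 885 required for 17 and 16.
  bound X = if X <ᵇ 65 then 900 else if X <ᵇ 256 then 123 else 52

  -- The names tell which of `X` and `Y` is a proper power. If one of them is not, it is enumerated
  -- through the difference: `16η² < X` allows at most 3 for `X < 256` and at most 9 for `X < 1600`.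
  sep₁₁ sepX sepY : ℕ → ℕ → Bool
  sep₁₁ X Y = separated (bound X) X Y X Y
  sepX e X = all< 9 λ η → separated (bound X) e (X ∸ suc η) X (X ∸ suc η)
  sepY f Y = all< 9 λ η → separated (bound (Y + suc η)) (Y + suc η) f (Y + suc η) Y

  -- Since both orders are tested, `allXY` can let its first exponent start at 3: two squares are
  -- excluded by `equal-exponents`.
  sepXY : ℕ → ℕ → ℕ → ℕ → Bool
  sepXY e X f Y = separated (bound X) e f X Y ∧ separated (bound Y) f e Y X

  powers : ℕ → ℕ → (ℕ → ℕ → Bool) → Bool
  powers M k P = allPowers 1000 M k P 2

  powers-sound : ∀ M k P → T (powers M k P) → ∀ {y} → 2 ≤ y → y ^ k < M → T (P y (y ^ k))
  powers-sound M k P t = allPowers-sound 1000 M k P 2 t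

  all₁₁ allX allY allXY : ℕ → Bool
  all₁₁ X = all< 3 λ η → sep₁₁ X (X ∸ suc η)
  allX α = powers 1600 (2 + α) sepX
  allY β = powers 1600 (2 + β) sepY

  cellXY : ℕ → ℕ → ℕ → Bool
  cellXY e X β = powers (2 ^ 19) (2 + β) (sepXY e X)

  rowXY : ℕ → ℕ → Bool
  rowXY e X = all< 17 (cellXY e X)

  allXY α = powers (2 ^ 19) (3 + α) rowXY

  opaque
    unfolding separated

    check₁₁ : T (all< 256 all₁₁)
    check₁₁ = tt

    checkX : T (all< 9 allX)
    checkX = tt

    checkY : T (all< 9 allY)
    checkY = tt

    checkXY : T (all< 16 allXY)
    checkXY = tt

  -- Large exponents

  ^-cancelʳ-< : ∀ n {x y} → x ^ n < y ^ n → x < y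
  ^-cancelʳ-< n lt = ≰⇒> λ y≤x → <⇒≱ lt (^-monoˡ-≤ n y≤x)

  ^-swap : ∀ x m n → (x ^ m) ^ n ≡ (x ^ n) ^ m
  ^-swap x m n = trans (^-*-assoc x m n) (trans (cong (x ^_) (*-comm m n)) (sym (^-*-assoc x n m)))

  ceiling : ∀ m n → ∃ λ q → m ≤ q * suc n × q * suc n ≤ m + n
  ceiling m n = (m + n) / suc n ,
    +-cancelˡ-≤ n _ _ (begin
      n + m                                              ≡⟨ +-comm n m ⟩
      m + n                                              ≡⟨ m≡m%n+[m/n]*n (m + n) (suc n) ⟩
      (m + n) % suc n + (m + n) / suc n * suc n          ≤⟨ +-monoˡ-≤ _ (s≤s⁻¹ (m%n<n (m + n) (suc n))) ⟩
      n + (m + n) / suc n * suc n                        ∎) ,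
    m/n*n≤m (m + n) (suc n)
    where open ≤-Reasoning

  module _ (Y η : ℕ) where
    open Approximants Y η

    private
      SignParity : ℕ → Set
      SignParity p =
        ((∀ {c m n} → SignedCong c p m n → SignedCong c 0 m n) ×
         (∀ {c m n} → SignedCong c (suc p) m n → SignedCong c 1 m n)) ⊎
        ((∀ {c m n} → SignedCong c p m n → SignedCong c 1 m n) ×
         (∀ {c m n} → SignedCong c (suc p) m n → SignedCong c 0 m n))

      signParity : ∀ p → SignParity p
      signParity zero          = inj₁ ((λ r → r) , (λ r → r))
      signParity (suc zero)    = inj₂ ((λ r → r) , (λ r → r))
      signParity (suc (suc p)) = signParity p

    -- It is not known which of `U` and `V` is larger, hence not which parity is needed. The later
    -- estimates therefore leave room for two consecutive values.
    offset : ∀ p {U V δ} → (U ≡ V + δ ⊎ V ≡ U + δ) → Offset U V δ p ⊎ Offset U V δ (suc p)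
    offset p (inj₁ eq) with signParity p
    ... | inj₁ (s , _) = inj₁ (above eq s)
    ... | inj₂ (_ , s) = inj₂ (above eq s)
    offset p (inj₂ eq) with signParity p
    ... | inj₁ (_ , s) = inj₂ (below eq s)
    ... | inj₂ (s , _) = inj₁ (below eq s)

  -- δ is below √(V/15), so 2δT < RV as soon as T² ≤ R²P with P ≤ (16/15)V.
  error-bound : ∀ δ V P T R .{{_ : NonZero R}} → 15 * (δ * δ) < V → 15 * P ≤ 16 * V →
    T * T ≤ R * R * P → 2 * δ * T < R * V
  error-bound δ V P T R δ<V P≤V T≤R = ^-cancelʳ-< 2 (*-cancelˡ-< 225 _ _ (begin-strict
    225 * (2 * δ * T) ^ 2              ≡⟨ l₁ δ T ⟩
    60 * (15 * (δ * δ) * (T * T))      ≤⟨ *-monoʳ-≤ 60 (*-monoʳ-≤ (15 * (δ * δ)) T≤R) ⟩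
    60 * (15 * (δ * δ) * (R * R * P))  ≡⟨ l₂ (15 * (δ * δ)) (R * R) P ⟩
    4 * (15 * (δ * δ) * (R * R)) * (15 * P)  ≤⟨ *-monoʳ-≤ (4 * (15 * (δ * δ) * (R * R))) P≤V ⟩
    4 * (15 * (δ * δ) * (R * R)) * (16 * V)  ≡⟨ l₃ (15 * (δ * δ)) (R * R) V ⟩
    64 * (R * R * V) * (15 * (δ * δ))  <⟨ *-monoʳ-< (64 * (R * R * V)) {{RRV≢0}} δ<V ⟩
    64 * (R * R * V) * V               ≤⟨ *-monoˡ-≤ V (*-monoˡ-≤ (R * R * V) (≤ᵇ⇒≤ 64 225 tt)) ⟩
    225 * (R * R * V) * V              ≡⟨ l₄ R V ⟩
    225 * (R * V) ^ 2                  ∎))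
    where
    open ≤-Reasoning
    instance
      V≢0 : NonZero V
      V≢0 = >-nonZero (≤-<-trans z≤n δ<V)
    RRV≢0 : NonZero (64 * (R * R * V))
    RRV≢0 = m*n≢0 64 (R * R * V) {{_}} {{m*n≢0 (R * R) V {{m*n≢0 R R}}}}
    l₁ : ∀ δ T → 225 * (2 * δ * T * (2 * δ * T * 1)) ≡ 60 * (15 * (δ * δ) * (T * T))
    l₁ = solve-∀
    l₂ : ∀ a b P → 60 * (a * (b * P)) ≡ 4 * (a * b) * (15 * P)
    l₂ = solve-∀
    l₃ : ∀ a b V → 4 * (a * b) * (16 * V) ≡ 64 * (b * V) * a
    l₃ = solve-∀
    l₄ : ∀ R V → 225 * (R * R * V) * V ≡ 225 * (R * V * (R * V * 1))
    l₄ = solve-∀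

  X+Y≤2X : ∀ Y η → Y + η + Y ≤ 2 * (Y + η)
  X+Y≤2X Y η = ≤-trans (+-monoʳ-≤ (Y + η) (m≤m+n Y η)) (≤-reflexive (l (Y + η)))
    where
    l : ∀ X → X + X ≡ 2 * X
    l = solve-∀

  record Approach (Y η H U V δ : ℕ) : Set where
    field
      direction : U ≡ V + δ ⊎ V ≡ U + δ
      15δ²<V    : 15 * (δ * δ) < V
      X^H∣U     : (Y + η) ^ H ∣ U
      X^H≤V     : 15 * (Y + η) ^ H ≤ 16 * V

  -- The nearly symmetric choice: `q + 1` copies of `X` and `q` of `Y`, giving exponents `H` for `X`
  -- and `H + 1` for `Y`. Keeping `N` a variable tied to `suc H` by an equation prevents `Y ^ N`
  -- from unfolding.
  module Large (Y η H N : ℕ) (N≡1+H : N ≡ suc H) .{{_ : NonZero Y}} .{{_ : NonZero η}} where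

    private
      X = Y + η
      instance
        X≢0 : NonZero X
        X≢0 = >-nonZero (≤-trans (>-nonZero⁻¹ Y) (m≤m+n Y η))

    φ^20≤ : ∀ {φ′} → X ^ 20 ≤ 2 * Y ^ 20 → Y ^ N * φ′ ≤ X ^ N → φ′ ^ 20 ≤ 2 ^ N
    φ^20≤ {φ′} ratio φ′≤ = *-cancelʳ-≤ _ _ ((Y ^ N) ^ 20) {{m^n≢0 (Y ^ N) 20 {{m^n≢0 Y (N)}}}} (begin
      φ′ ^ 20 * (Y ^ N) ^ 20    ≡⟨ *-comm (φ′ ^ 20) _ ⟩
      (Y ^ N) ^ 20 * φ′ ^ 20    ≡⟨ sym (^-distribʳ-* 20 (Y ^ N) φ′) ⟩
      (Y ^ N * φ′) ^ 20         ≤⟨ ^-monoˡ-≤ 20 φ′≤ ⟩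
      (X ^ N) ^ 20              ≡⟨ ^-swap X (N) 20 ⟩
      (X ^ 20) ^ N              ≤⟨ ^-monoˡ-≤ (N) ratio ⟩
      (2 * Y ^ 20) ^ N          ≡⟨ ^-distribʳ-* (N) 2 (Y ^ 20) ⟩
      2 ^ N * (Y ^ 20) ^ N  ≡⟨ cong (2 ^ N *_) (^-swap Y 20 (N)) ⟩
      2 ^ N * (Y ^ N) ^ 20  ∎)
      where open ≤-Reasoning

    module _ (φ′ q : ℕ) (φ′^20 : φ′ ^ 20 ≤ 2 ^ N) (lo : 7 * N ≤ q * 20) (hi : q * 20 ≤ 7 * N + 39) where

      -- The origin of 7/20: the 20th power of the left side is at most `2 ^ (21 * N)`, which is
      -- `8 ^ (7 * N)`.
      2^H*φ≤8^q : 2 ^ N * φ′ ≤ 8 ^ q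
      2^H*φ≤8^q = ^-cancelʳ-≤ 20 (begin
        (2 ^ N * φ′) ^ 20              ≡⟨ ^-distribʳ-* 20 (2 ^ N) φ′ ⟩
        (2 ^ N) ^ 20 * φ′ ^ 20         ≤⟨ *-monoʳ-≤ ((2 ^ N) ^ 20) φ′^20 ⟩
        (2 ^ N) ^ 20 * 2 ^ N       ≡⟨ *-comm ((2 ^ N) ^ 20) (2 ^ N) ⟩
        (2 ^ N) ^ 21                   ≡⟨ ^-*-assoc 2 N 21 ⟩
        2 ^ (N * 21)                   ≡⟨ cong (2 ^_) (l (N)) ⟩
        2 ^ (3 * (7 * N))              ≡⟨ sym (^-*-assoc 2 3 (7 * N)) ⟩
        8 ^ (7 * N)                    ≤⟨ ^-monoʳ-≤ 8 lo ⟩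
        8 ^ (q * 20)                       ≡⟨ sym (^-*-assoc 8 q 20) ⟩
        (8 ^ q) ^ 20                       ∎)
        where
        open ≤-Reasoning
        l : ∀ n → n * 21 ≡ 3 * (7 * n)
        l = solve-∀

      -- In 20th powers the left side is at most `2 ^ (30 * N + 156) * X ^ (14 * N + 78)`. About
      -- `6H` of the `20H` available factors `X` remain to absorb the power of 2, so `X` has to
      -- exceed `2 ^ 5`.
      S²≤X^H : ∀ k → k + (14 * N + 78) ≤ H * 20 → 2 ^ (30 * N + 156) ≤ X ^ k →
        (φ′ * (4 ^ q * X ^ q)) ^ 2 ≤ X ^ H
      S²≤X^H k k≤ 2≤X = ^-cancelʳ-≤ 20 (begin
        ((φ′ * (4 ^ q * X ^ q)) ^ 2) ^ 20
          ≡⟨ ^-swap (φ′ * (4 ^ q * X ^ q)) 2 20 ⟩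
        ((φ′ * (4 ^ q * X ^ q)) ^ 20) ^ 2
          ≡⟨ cong (_^ 2) (trans (^-distribʳ-* 20 φ′ _) (cong (φ′ ^ 20 *_) (^-distribʳ-* 20 (4 ^ q) (X ^ q)))) ⟩
        (φ′ ^ 20 * ((4 ^ q) ^ 20 * (X ^ q) ^ 20)) ^ 2
          ≤⟨ ^-monoˡ-≤ 2 (*-mono-≤ φ′^20 (*-mono-≤ 4≤ X≤)) ⟩
        (2 ^ N * (2 ^ (2 * (7 * N + 39)) * X ^ (7 * N + 39))) ^ 2
          ≡⟨ cong (_^ 2) (trans (sym (*-assoc (2 ^ N) _ _)) (cong (_* X ^ (7 * N + 39)) (sym (^-distribˡ-+-* 2 (N) _)))) ⟩
        (2 ^ (N + 2 * (7 * N + 39)) * X ^ (7 * N + 39)) ^ 2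
          ≡⟨ ^-distribʳ-* 2 (2 ^ (N + 2 * (7 * N + 39))) _ ⟩
        (2 ^ (N + 2 * (7 * N + 39))) ^ 2 * (X ^ (7 * N + 39)) ^ 2
          ≡⟨ cong₂ _*_ (trans (^-*-assoc 2 (N + 2 * (7 * N + 39)) 2) (cong (2 ^_) (l₁ N)))
                       (trans (^-*-assoc X (7 * N + 39) 2) (cong (X ^_) (l₂ N))) ⟩
        2 ^ (30 * N + 156) * X ^ (14 * N + 78)
          ≤⟨ *-monoˡ-≤ (X ^ (14 * N + 78)) 2≤X ⟩
        X ^ k * X ^ (14 * N + 78)
          ≡⟨ sym (^-distribˡ-+-* X k (14 * N + 78)) ⟩
        X ^ (k + (14 * N + 78))
          ≤⟨ ^-monoʳ-≤ X k≤ ⟩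
        X ^ (H * 20)
          ≡⟨ sym (^-*-assoc X H 20) ⟩
        (X ^ H) ^ 20 ∎)
        where
        open ≤-Reasoning
        l₁ : ∀ N → (N + 2 * (7 * N + 39)) * 2 ≡ 30 * N + 156
        l₁ = solve-∀
        l₂ : ∀ N → (7 * N + 39) * 2 ≡ 14 * N + 78
        l₂ = solve-∀
        4≤ : (4 ^ q) ^ 20 ≤ 2 ^ (2 * (7 * N + 39))
        4≤ = ≤-trans (≤-reflexive (^-*-assoc 4 q 20))
               (≤-trans (^-monoʳ-≤ 4 hi) (≤-reflexive (^-*-assoc 2 2 (7 * N + 39))))
        X≤ : (X ^ q) ^ 20 ≤ X ^ (7 * N + 39)
        X≤ = ≤-trans (≤-reflexive (^-*-assoc X q 20)) (^-monoʳ-≤ X hi)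

    -- q/H ≥ 7/20 makes the first error term small; a larger q spoils the second one.
    large-X-at : ∀ U V φ φ′ δ .{{_ : NonZero V}} .{{_ : NonZero φ′}} → Approach Y η H U V δ →
      V * φ ≡ Y ^ N * φ′ → Y ^ N * φ′ ≤ X ^ N →
      16 * (η * η) < X → X ^ 20 ≤ 2 * Y ^ 20 →
      4 ≤ H → ∀ k → k + (14 * N + 78) ≤ H * 20 → 2 ^ (30 * N + 156) ≤ X ^ k →
      ∀ q → 7 * N ≤ q * 20 → q * 20 ≤ 7 * N + 39 → Approximants.Offset Y η U V δ (suc q) → ⊥
    large-X-at U V φ φ′ δ app eq φ′≤ gap ratio 4≤H k k≤ 2≤X q lo hi off = Approximants.approximation-contradiction Y η q q K
        (trans eq (cong (λ n → Y ^ n * φ′) N≡K+1+q))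
        (subst (λ n → X ^ n ∣ U) (sym K+q) X^H∣U)
        off C₁ C₂
      where
      open Approach app
      open ≤-Reasoning
      q≤H : q ≤ H
      q≤H = *-cancelʳ-≤ q H 20 (begin
        q * 20            ≤⟨ hi ⟩
        7 * N + 39        ≡⟨ trans (cong (λ n → 7 * n + 39) N≡1+H) (l H) ⟩
        7 * H + 46        ≤⟨ +-monoʳ-≤ (7 * H) (≤-trans (≤ᵇ⇒≤ 46 52 tt) (*-monoʳ-≤ 13 4≤H)) ⟩
        7 * H + 13 * H    ≡⟨ l′ H ⟩
        H * 20            ∎)
        where
        l : ∀ H → 7 * suc H + 39 ≡ 7 * H + 46
        l = solve-∀
        l′ : ∀ H → 7 * H + 13 * H ≡ H * 20
        l′ = solve-∀
      K = H ∸ q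
      K+q : K + q ≡ H
      K+q = m∸n+n≡m q≤H
      K+2q : K + (q + q) ≡ H + q
      K+2q = trans (sym (+-assoc K q q)) (cong (_+ q) K+q)
      N≡K+1+q : N ≡ K + suc q
      N≡K+1+q = trans (trans N≡1+H (cong suc (sym K+q))) (sym (+-suc K q))
      φ^20 = φ^20≤ ratio φ′≤
      -- The bound `8 ^ q` for `2 ^ N * φ′` and the remaining `2 ^ q` make up `16 ^ q`, so the gap
      -- hypothesis applies with its own constant.
      C₁ : 2 * φ′ * η ^ (q + q) * 2 ^ (K + (q + q)) < (X + η) ^ q
      C₁ = begin-strict
        2 * φ′ * η ^ (q + q) * 2 ^ (K + (q + q))
          ≡⟨ cong₂ (λ a b → 2 * φ′ * a * b) (trans (^-distribˡ-+-* η q q) (sym (^-distribʳ-* q η η)))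
               (trans (cong (2 ^_) K+2q) (^-distribˡ-+-* 2 H q)) ⟩
        2 * φ′ * (η * η) ^ q * (2 ^ H * 2 ^ q)
          ≡⟨ trans (l φ′ ((η * η) ^ q) (2 ^ H) (2 ^ q)) (cong (λ n → 2 ^ n * φ′ * (2 ^ q * (η * η) ^ q)) (sym N≡1+H)) ⟩
        2 ^ N * φ′ * (2 ^ q * (η * η) ^ q)
          ≤⟨ *-monoˡ-≤ (2 ^ q * (η * η) ^ q) (2^H*φ≤8^q φ′ q φ^20 lo hi) ⟩
        8 ^ q * (2 ^ q * (η * η) ^ q)
          ≡⟨ trans (sym (*-assoc (8 ^ q) (2 ^ q) _)) (cong (_* (η * η) ^ q) (sym (^-distribʳ-* q 8 2))) ⟩
        16 ^ q * (η * η) ^ q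
          ≡⟨ sym (^-distribʳ-* q 16 (η * η)) ⟩
        (16 * (η * η)) ^ q
          <⟨ ^-monoˡ-< q {{q≢0}} (<-≤-trans gap (m≤m+n X η)) ⟩
        (X + η) ^ q ∎
        where
        l : ∀ a b c d → 2 * a * b * (c * d) ≡ 2 * c * a * (d * b)
        l = solve-∀
        q≢0 : NonZero q
        q≢0 = ≢-nonZero λ { refl → n≮0 (≤-trans (≤-trans (s≤s z≤n) (≤-reflexive (sym (cong (7 *_) N≡1+H)))) lo) }
      -- `S` is what the left side has beyond `R`, apart from `2δ`. As `δ` is about `√V / 4` at
      -- most, `S² ≤ X ^ H` is good enough.
      C₂ : 2 * φ′ * δ * (X + Y) ^ (K + (q + q)) < 2 ^ K * X ^ (K + q) * V
      C₂ = begin-strict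
        2 * φ′ * δ * (X + Y) ^ (K + (q + q))
          ≡⟨ l₀ φ′ δ ((X + Y) ^ (K + (q + q))) ⟩
        2 * δ * (φ′ * (X + Y) ^ (K + (q + q)))
          <⟨ error-bound δ V (X ^ H) (φ′ * (X + Y) ^ (K + (q + q))) R {{R≢0}} 15δ²<V X^H≤V T²≤ ⟩
        2 ^ K * X ^ (K + q) * V ∎
        where
        R = 2 ^ K * X ^ (K + q)
        S = φ′ * (4 ^ q * X ^ q)
        R≢0 : NonZero R
        R≢0 = m*n≢0 (2 ^ K) (X ^ (K + q)) {{m^n≢0 2 K}} {{m^n≢0 X (K + q)}}
        l₀ : ∀ a b c → 2 * a * b * c ≡ 2 * b * (a * c)
        l₀ = solve-∀
        T≤RS : φ′ * (X + Y) ^ (K + (q + q)) ≤ R * S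
        T≤RS = begin
          φ′ * (X + Y) ^ (K + (q + q))
            ≤⟨ *-monoʳ-≤ φ′ (^-monoˡ-≤ (K + (q + q)) (X+Y≤2X Y η)) ⟩
          φ′ * (2 * X) ^ (K + (q + q))
            ≡⟨ cong (φ′ *_) (^-distribʳ-* (K + (q + q)) 2 X) ⟩
          φ′ * (2 ^ (K + (q + q)) * X ^ (K + (q + q)))
            ≡⟨ cong₂ (λ a b → φ′ * (a * b))
                 (trans (^-distribˡ-+-* 2 K (q + q)) (cong (2 ^ K *_) (trans (^-distribˡ-+-* 2 q q) (sym (^-distribʳ-* q 2 2)))))
                 (trans (cong (X ^_) (sym (+-assoc K q q))) (^-distribˡ-+-* X (K + q) q)) ⟩
          φ′ * (2 ^ K * 4 ^ q * (X ^ (K + q) * X ^ q))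
            ≡⟨ l φ′ (2 ^ K) (4 ^ q) (X ^ (K + q)) (X ^ q) ⟩
          R * S ∎
          where
          l : ∀ f a b c d → f * (a * b * (c * d)) ≡ a * c * (f * (b * d))
          l = solve-∀
        T²≤ : φ′ * (X + Y) ^ (K + (q + q)) * (φ′ * (X + Y) ^ (K + (q + q))) ≤ R * R * X ^ H
        T²≤ = begin
          φ′ * (X + Y) ^ (K + (q + q)) * (φ′ * (X + Y) ^ (K + (q + q)))  ≤⟨ *-mono-≤ T≤RS T≤RS ⟩
          R * S * (R * S)                ≡⟨ l R S ⟩
          R * R * (S * (S * 1))          ≤⟨ *-monoʳ-≤ (R * R) (S²≤X^H φ′ q φ^20 lo hi k k≤ 2≤X) ⟩
          R * R * X ^ H                  ∎
          where
          l : ∀ R S → R * S * (R * S) ≡ R * R * (S * (S * 1))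
          l = solve-∀

    large-X : ∀ U V φ φ′ δ .{{_ : NonZero V}} .{{_ : NonZero φ′}} → Approach Y η H U V δ →
      V * φ ≡ Y ^ N * φ′ → Y ^ N * φ′ ≤ X ^ N →
      16 * (η * η) < X → X ^ 20 ≤ 2 * Y ^ 20 →
      4 ≤ H → ∀ k → k + (14 * N + 78) ≤ H * 20 → 2 ^ (30 * N + 156) ≤ X ^ k → ⊥
    large-X U V φ φ′ δ app eq φ′≤ gap ratio 4≤H k k≤ 2≤X =
      -- Rounding up costs at most 19, and moving to `suc q` for the parity another 20; hence the 39
      -- in the estimates.
      let q , lo , hi = ceiling (7 * N) 19 in
      [ large-X-at U V φ φ′ δ app eq φ′≤ gap ratio 4≤H k k≤ 2≤X q lo (widen q hi)
      , large-X-at U V φ φ′ δ app eq φ′≤ gap ratio 4≤H k k≤ 2≤X (suc q)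
          (≤-trans lo (*-monoˡ-≤ 20 (n≤1+n q))) (widen-suc q hi)
      ]′ (offset Y η (suc q) (Approach.direction app))
      where
      widen : ∀ q → q * 20 ≤ 7 * N + 19 → q * 20 ≤ 7 * N + 39
      widen q hi = ≤-trans hi (+-monoʳ-≤ (7 * N) (≤ᵇ⇒≤ 19 39 tt))
      l : ∀ N → 20 + (7 * N + 19) ≡ 7 * N + 39
      l = solve-∀
      widen-suc : ∀ q → q * 20 ≤ 7 * N + 19 → suc q * 20 ≤ 7 * N + 39
      widen-suc q hi = ≤-trans (+-monoʳ-≤ 20 hi) (≤-reflexive (l N))

  -- Fourier–Motzkin elimination of q and then of d.
  eliminate : ∀ s t .{{_ : NonZero s}} .{{_ : NonZero t}} g r w n A B C D e {H d q} →
    s * q ≤ g * (H + d) + r → t * d ≤ H + w → n ≤ H →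
    s * t * D ≡ s * A + B * g + t * (B * g) + e →
    (s * A + B * g) * w + t * (B * r + s * C) ≤ e * n →
    A * d + B * q + C ≤ D * H
  eliminate s t g r w n A B C D e {H} {d} {q} q≤ d≤ n≤H eq const =
    *-cancelˡ-≤ (s * t) {{m*n≢0 s t}} (begin
      s * t * (A * d + B * q + C)                        ≡⟨ l₁ s t A B C d q ⟩
      t * (B * (s * q)) + s * t * (A * d + C)            ≤⟨ +-monoˡ-≤ (s * t * (A * d + C)) (*-monoʳ-≤ t (*-monoʳ-≤ B q≤)) ⟩
      t * (B * (g * (H + d) + r)) + s * t * (A * d + C)  ≡⟨ l₂ s t A B C g r d H ⟩
      (s * A + B * g) * (t * d) + rest                   ≤⟨ +-monoˡ-≤ rest (*-monoʳ-≤ (s * A + B * g) d≤) ⟩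
      (s * A + B * g) * (H + w) + rest                   ≡⟨ l₃ (s * A + B * g) (t * (B * g)) (t * (B * r + s * C)) w H ⟩
      (s * A + B * g + t * (B * g)) * H + ((s * A + B * g) * w + t * (B * r + s * C))
                                                         ≤⟨ +-monoʳ-≤ ((s * A + B * g + t * (B * g)) * H) (≤-trans const (*-monoʳ-≤ e n≤H)) ⟩
      (s * A + B * g + t * (B * g)) * H + e * H          ≡⟨ sym (*-distribʳ-+ H (s * A + B * g + t * (B * g)) e) ⟩
      (s * A + B * g + t * (B * g) + e) * H              ≡⟨ cong (_* H) (sym eq) ⟩
      s * t * D * H                                      ≡⟨ *-assoc (s * t) D H ⟩
      s * t * (D * H)                                    ∎)
    where
    open ≤-Reasoning
    rest = t * (B * g) * H + t * (B * r + s * C)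
    l₁ : ∀ s t A B C d q → s * t * (A * d + B * q + C) ≡ t * (B * (s * q)) + s * t * (A * d + C)
    l₁ = solve-∀
    l₂ : ∀ s t A B C g r d H → t * (B * (g * (H + d) + r)) + s * t * (A * d + C) ≡
      (s * A + B * g) * (t * d) + (t * (B * g) * H + t * (B * r + s * C))
    l₂ = solve-∀
    l₃ : ∀ E F Z w H → E * (H + w) + (F * H + Z) ≡ (E + F) * H + (E * w + Z)
    l₃ = solve-∀

  -- The symmetric estimate fails near 17, where `(X / Y) ^ 20` exceeds 2 and `X` is below 32. Here
  -- `V` divides `Y ^ L`, so `φ′` is 1, and `d` additional copies of `X` raise the exponent of `Y`
  -- from `H` to `L`.
  module UnitGap (Y H L d : ℕ) (L≡H+d : L ≡ H + d) .{{_ : NonZero Y}} where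

    private
      X = Y + 1
      instance
        X≢0 : NonZero X
        X≢0 = >-nonZero (≤-trans (>-nonZero⁻¹ Y) (m≤m+n Y 1))

    unit-gap-at : ∀ U V φ δ .{{_ : NonZero V}} → Approach Y 1 H U V δ → V * φ ≡ Y ^ L →
      ∀ q → suc q ≤ H → Approximants.Offset Y 1 U V δ (suc (q + d)) →
      2 ^ (L + suc q) < (X + 1) ^ suc q →
      ((X + Y) ^ (L + q)) ^ 2 * 4 ^ suc q ≤ 4 ^ H * (X ^ H) ^ 3 → ⊥
    unit-gap-at U V φ δ app eq q q<H off C C′ =
      Approximants.approximation-contradiction Y 1 (q + d) (suc q) K {φ′ = 1}
        (trans eq (trans (cong (Y ^_) (sym K+1+p)) (sym (*-identityʳ _))))
        (subst (λ n → X ^ n ∣ U) (sym K+q) X^H∣U)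
        off C₁ C₂
      where
      open Approach app
      open ≤-Reasoning
      K = H ∸ suc q
      K+q : K + suc q ≡ H
      K+q = m∸n+n≡m q<H
      K+1+p : K + suc (q + d) ≡ L
      K+1+p = trans (sym (+-assoc K (suc q) d)) (trans (cong (_+ d) K+q) (sym L≡H+d))
      N≡ : K + (q + d + suc q) ≡ L + q
      N≡ = trans (l K q d) (trans (cong (λ n → n + d + q) K+q) (cong (_+ q) (sym L≡H+d)))
        where
        l : ∀ K q d → K + (q + d + suc q) ≡ K + suc q + d + q
        l = solve-∀
      C₁ : 2 * 1 * 1 ^ (q + d + suc q) * 2 ^ (K + (q + d + suc q)) < (X + 1) ^ suc q
      C₁ = begin-strict
        2 * 1 * 1 ^ (q + d + suc q) * 2 ^ (K + (q + d + suc q))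
          ≡⟨ cong₂ (λ a b → 2 * 1 * a * 2 ^ b) (^-zeroˡ (q + d + suc q)) N≡ ⟩
        2 * 2 ^ (L + q)     ≡⟨ cong (2 ^_) (sym (+-suc L q)) ⟩
        2 ^ (L + suc q)     <⟨ C ⟩
        (X + 1) ^ suc q     ∎
      R = 2 ^ K * X ^ (K + suc q)
      R≢0 : NonZero R
      R≢0 = m*n≢0 (2 ^ K) (X ^ (K + suc q)) {{m^n≢0 2 K}} {{m^n≢0 X (K + suc q)}}
      Z = (X + Y) ^ (K + (q + d + suc q))
      Z²≤ : Z * Z ≤ R * R * X ^ H
      Z²≤ = *-cancelʳ-≤ _ _ (4 ^ suc q) {{m^n≢0 4 (suc q)}} (begin
        Z * Z * 4 ^ suc q
          ≡⟨ cong (λ n → (X + Y) ^ n * (X + Y) ^ n * 4 ^ suc q) N≡ ⟩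
        (X + Y) ^ (L + q) * (X + Y) ^ (L + q) * 4 ^ suc q
          ≡⟨ cong (λ n → (X + Y) ^ (L + q) * n * 4 ^ suc q) (sym (*-identityʳ _)) ⟩
        ((X + Y) ^ (L + q)) ^ 2 * 4 ^ suc q
          ≤⟨ C′ ⟩
        4 ^ H * (X ^ H) ^ 3
          ≡⟨ cong (_* (X ^ H) ^ 3) (trans (cong (4 ^_) (sym K+q)) (trans (^-distribˡ-+-* 4 K (suc q))
               (cong (_* 4 ^ suc q) (^-distribʳ-* K 2 2)))) ⟩
        2 ^ K * 2 ^ K * 4 ^ suc q * (X ^ H * (X ^ H * (X ^ H * 1)))
          ≡⟨ l (2 ^ K) (4 ^ suc q) (X ^ H) ⟩
        2 ^ K * X ^ H * (2 ^ K * X ^ H) * X ^ H * 4 ^ suc q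
          ≡⟨ cong (λ n → 2 ^ K * X ^ n * (2 ^ K * X ^ n) * X ^ H * 4 ^ suc q) (sym K+q) ⟩
        R * R * X ^ H * 4 ^ suc q ∎)
        where
        l : ∀ a b c → a * a * b * (c * (c * (c * 1))) ≡ a * c * (a * c) * c * b
        l = solve-∀
      C₂ : 2 * 1 * δ * Z < R * V
      C₂ = error-bound δ V (X ^ H) Z R {{R≢0}} 15δ²<V X^H≤V Z²≤

    -- The first condition holds from 18 on, as 2^(25/6) is about 17.96. The last one expresses log
    -- X / log Y ≤ 50/49.
    module _ (X^12 : 4 ^ 25 ≤ X ^ 12) (18≤X : 18 ≤ X) (900≤H : 900 ≤ H) (49d≤ : 49 * d ≤ H + 98) where

      private
        -- After taking 25th powers and replacing `4 ^ 25` by `X ^ 12`, the inequality `key`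
        -- compares the exponents `12(2q + d + 1) + 50(q + d)` and `25H`. The slack `427 * H`
        -- absorbs the constants from 844 on.
        linear : ∀ q → 29 * q ≤ 9 * (H + d) + 28 → 62 * d + 74 * q + 12 ≤ 25 * H
        linear q hi = eliminate 29 49 9 28 98 900 62 74 12 25 427 {H} {d} {q} hi 49d≤ 900≤H refl (≤ᵇ⇒≤ _ _ tt)

        -- `L + Q` is at most 38/9 times `Q`, and 38/9 lies just below log₂ 19.
        C : ∀ Q .{{_ : NonZero Q}} → 9 * L ≤ 29 * Q → 2 ^ (L + Q) < (X + 1) ^ Q
        C Q lo = <-≤-trans (^-cancelʳ-< 9 (begin-strict
          (2 ^ (L + Q)) ^ 9      ≡⟨ ^-*-assoc 2 (L + Q) 9 ⟩
          2 ^ ((L + Q) * 9)      ≤⟨ ^-monoʳ-≤ 2 (≤-trans (≤-reflexive (l L (Q))) (≤-trans (+-monoˡ-≤ (9 * Q) lo) (≤-reflexive (l′ (Q))))) ⟩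
          2 ^ (38 * Q)           ≡⟨ sym (^-*-assoc 2 38 (Q)) ⟩
          (2 ^ 38) ^ Q           <⟨ ^-monoˡ-< (Q) (≤ᵇ⇒≤ (suc (2 ^ 38)) (19 ^ 9) tt) ⟩
          (19 ^ 9) ^ Q           ≡⟨ ^-swap 19 9 (Q) ⟩
          (19 ^ Q) ^ 9           ∎)) (^-monoˡ-≤ (Q) (+-monoˡ-≤ 1 18≤X))
          where
          open ≤-Reasoning
          l : ∀ L q → (L + q) * 9 ≡ 9 * L + 9 * q
          l = solve-∀
          l′ : ∀ q → 29 * q + 9 * q ≡ 38 * q
          l′ = solve-∀

        C′ : ∀ q → 29 * q ≤ 9 * (H + d) + 28 → ((X + Y) ^ (L + q)) ^ 2 * 4 ^ suc q ≤ 4 ^ H * (X ^ H) ^ 3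
        C′ q hi = begin
          ((X + Y) ^ (L + q)) ^ 2 * 4 ^ suc q
            ≤⟨ *-monoˡ-≤ (4 ^ suc q) (^-monoˡ-≤ 2 (^-monoˡ-≤ (L + q) (X+Y≤2X Y 1))) ⟩
          ((2 * X) ^ (L + q)) ^ 2 * 4 ^ suc q
            ≡⟨ cong (_* 4 ^ suc q) (trans (cong (_^ 2) (^-distribʳ-* (L + q) 2 X)) (^-distribʳ-* 2 (2 ^ (L + q)) (X ^ (L + q)))) ⟩
          (2 ^ (L + q)) ^ 2 * (X ^ (L + q)) ^ 2 * 4 ^ suc q
            ≡⟨ cong₂ (λ a b → a * b * 4 ^ suc q)
                 (trans (^-swap 2 (L + q) 2) (trans (cong (4 ^_) L+q) (^-distribˡ-+-* 4 H p)))
                 (trans (cong (λ n → (X ^ n) ^ 2) L+q) (trans (cong (_^ 2) (^-distribˡ-+-* X H p)) (^-distribʳ-* 2 (X ^ H) (X ^ p)))) ⟩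
          4 ^ H * 4 ^ p * ((X ^ H) ^ 2 * (X ^ p) ^ 2) * 4 ^ suc q
            ≡⟨ l (4 ^ H) (4 ^ p) ((X ^ H) ^ 2) ((X ^ p) ^ 2) (4 ^ suc q) ⟩
          4 ^ H * (X ^ H) ^ 2 * (4 ^ p * 4 ^ suc q * (X ^ p) ^ 2)
            ≡⟨ cong (λ n → 4 ^ H * (X ^ H) ^ 2 * (n * (X ^ p) ^ 2)) (sym (^-distribˡ-+-* 4 p (suc q))) ⟩
          4 ^ H * (X ^ H) ^ 2 * (4 ^ (p + suc q) * (X ^ p) ^ 2)
            ≤⟨ *-monoʳ-≤ (4 ^ H * (X ^ H) ^ 2) key ⟩
          4 ^ H * (X ^ H) ^ 2 * X ^ H
            ≡⟨ l′ (4 ^ H) (X ^ H) ⟩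
          4 ^ H * (X ^ H) ^ 3 ∎
          where
          open ≤-Reasoning
          p = q + d
          L+q : L + q ≡ H + p
          L+q = trans (cong (_+ q) L≡H+d) (trans (+-assoc H d q) (cong (H +_) (+-comm d q)))
          l : ∀ a b c d e → a * b * (c * d) * e ≡ a * c * (b * e * d)
          l = solve-∀
          l′ : ∀ a b → a * (b * (b * 1)) * b ≡ a * (b * (b * (b * 1)))
          l′ = solve-∀
          key : 4 ^ (p + suc q) * (X ^ p) ^ 2 ≤ X ^ H
          key = ^-cancelʳ-≤ 25 (begin
            (4 ^ (p + suc q) * (X ^ p) ^ 2) ^ 25
              ≡⟨ ^-distribʳ-* 25 (4 ^ (p + suc q)) _ ⟩
            (4 ^ (p + suc q)) ^ 25 * ((X ^ p) ^ 2) ^ 25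
              ≡⟨ cong₂ _*_ (^-swap 4 (p + suc q) 25) (trans (cong (_^ 25) (^-*-assoc X p 2)) (^-*-assoc X (p * 2) 25)) ⟩
            (4 ^ 25) ^ (p + suc q) * X ^ (p * 2 * 25)
              ≤⟨ *-monoˡ-≤ (X ^ (p * 2 * 25)) (^-monoˡ-≤ (p + suc q) X^12) ⟩
            (X ^ 12) ^ (p + suc q) * X ^ (p * 2 * 25)
              ≡⟨ trans (cong (_* X ^ (p * 2 * 25)) (^-*-assoc X 12 (p + suc q))) (sym (^-distribˡ-+-* X (12 * (p + suc q)) (p * 2 * 25))) ⟩
            X ^ (12 * (p + suc q) + p * 2 * 25)
              ≤⟨ ^-monoʳ-≤ X (≤-trans (≤-reflexive (e q d)) (≤-trans (linear q hi) (≤-reflexive (*-comm 25 H)))) ⟩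
            X ^ (H * 25)
              ≡⟨ sym (^-*-assoc X H 25) ⟩
            (X ^ H) ^ 25 ∎)
            where
            e : ∀ q d → 12 * (q + d + suc q) + (q + d) * 2 * 25 ≡ 62 * d + 74 * q + 12
            e = solve-∀

      unit-gap : ∀ U V φ δ .{{_ : NonZero V}} → Approach Y 1 H U V δ → V * φ ≡ Y ^ L → ⊥
      unit-gap U V φ δ app eq = go (ceiling (9 * L) 28)
        where
        at : ∀ q → 9 * L ≤ q * 29 → q * 29 ≤ 9 * L + 57 → Approximants.Offset Y 1 U V δ (q + d) → ⊥
        at zero lo hi off = n≮0 (≤-trans (≤-trans (s≤s z≤n) (≤-trans 900≤H (≤-trans (m≤m+n H d) (≤-trans (≤-reflexive (sym L≡H+d)) (m≤n*m L 9))))) lo)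
        at (suc q) lo hi off = unit-gap-at U V φ δ app eq q q<H off
            (C (suc q) (≤-trans lo (≤-reflexive (*-comm (suc q) 29)))) (C′ q hi′)
          where
          open ≤-Reasoning
          hi′ : 29 * q ≤ 9 * (H + d) + 28
          hi′ = +-cancelˡ-≤ 29 _ _ (begin
            29 + 29 * q               ≡⟨ l₁ q ⟩
            suc q * 29                ≤⟨ hi ⟩
            9 * L + 57                ≡⟨ cong (λ n → 9 * n + 57) L≡H+d ⟩
            9 * (H + d) + 57          ≡⟨ l₂ (9 * (H + d)) ⟩
            29 + (9 * (H + d) + 28)   ∎)
            where
            l₁ : ∀ q → 29 + 29 * q ≡ suc q * 29
            l₁ = solve-∀
            l₂ : ∀ n → n + 57 ≡ 29 + (n + 28)
            l₂ = solve-∀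
          q<H : suc q ≤ H
          q<H = ≰⇒> λ H≤q → <⇒≱ (≤-<-trans (linear q hi′) (*-monoˡ-< H {{>-nonZero (≤-trans (s≤s z≤n) 900≤H)}} (≤ᵇ⇒≤ 26 74 tt)))
            (≤-trans (*-monoʳ-≤ 74 H≤q) (≤-trans (m≤n+m (74 * q) (62 * d)) (m≤m+n _ 12)))
        go : (∃ λ q → 9 * L ≤ q * 29 × q * 29 ≤ 9 * L + 28) → ⊥
        go (q , lo , hi) =
          -- Rounding up costs 28, and the possible parity step 29 more.
          [ at q lo (≤-trans hi (+-monoʳ-≤ (9 * L) (≤ᵇ⇒≤ 28 57 tt)))
          , at (suc q) (≤-trans lo (*-monoˡ-≤ 29 (n≤1+n q))) (≤-trans (+-monoʳ-≤ 29 hi) (≤-reflexive (l (9 * L))))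
          ]′ (offset Y 1 (q + d) (Approach.direction app))
          where
          l : ∀ n → 29 + (n + 28) ≡ n + 57
          l = solve-∀

  -- At `X = 17` the condition `4 ^ 25 ≤ X ^ 12` fails. Instead of passing from `X + Y` to `2 * X`,
  -- the value 33 is kept, and powers of 33 and 17 are compared with powers of 2.
  module Gap17-16 (H L d : ℕ) (L≡H+d : L ≡ H + d) (900≤H : 900 ≤ H) (45d≤ : 45 * d ≤ H + 90) where

    private
      -- Taking 45th and 103rd powers produces the coefficients: 46762 = 2·227·103, 9270 = 90·103,
      -- 56032 is their sum, and 19343 = 9270 + 3·45·421 - 46762. The slack is sufficient from
      -- `H = 885` on.
      linear : ∀ q → 19 * q ≤ 6 * (H + d) + 18 → 46762 * d + 56032 * q + 9270 ≤ 19343 * H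
      linear q hi = eliminate 19 45 6 18 90 900 46762 56032 9270 19343 184955 {H} {d} {q} hi 45d≤ 900≤H refl (≤ᵇ⇒≤ _ _ tt)

      -- Here 19/6 + 1 = 25/6 lies just below log₂ 18.
      C : ∀ Q .{{_ : NonZero Q}} → 6 * L ≤ 19 * Q → 2 ^ (L + Q) < 18 ^ Q
      C Q lo = ^-cancelʳ-< 6 (begin-strict
        (2 ^ (L + Q)) ^ 6      ≡⟨ ^-*-assoc 2 (L + Q) 6 ⟩
        2 ^ ((L + Q) * 6)      ≤⟨ ^-monoʳ-≤ 2 (≤-trans (≤-reflexive (l L (Q))) (≤-trans (+-monoˡ-≤ (6 * Q) lo) (≤-reflexive (l′ (Q))))) ⟩
        2 ^ (25 * Q)           ≡⟨ sym (^-*-assoc 2 25 (Q)) ⟩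
        (2 ^ 25) ^ Q           <⟨ ^-monoˡ-< (Q) (≤ᵇ⇒≤ (suc (2 ^ 25)) (18 ^ 6) tt) ⟩
        (18 ^ 6) ^ Q           ≡⟨ ^-swap 18 6 (Q) ⟩
        (18 ^ Q) ^ 6           ∎)
        where
        open ≤-Reasoning
        l : ∀ L q → (L + q) * 6 ≡ 6 * L + 6 * q
        l = solve-∀
        l′ : ∀ q → 19 * q + 6 * q ≡ 25 * q
        l′ = solve-∀

      -- 227/45 and 421/103 are good rational approximations of log₂ 33 from above and log₂ 17 from below.
      33^n≤ : ∀ n → (33 ^ n) ^ 45 ≤ 2 ^ (227 * n)
      33^n≤ n = ≤-trans (≤-reflexive (^-swap 33 n 45))
        (≤-trans (^-monoˡ-≤ n (≤ᵇ⇒≤ (33 ^ 45) (2 ^ 227) tt)) (≤-reflexive (^-*-assoc 2 227 n)))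

      17^n≥ : ∀ n → 2 ^ (421 * n) ≤ (17 ^ n) ^ 103
      17^n≥ n = ≤-trans (≤-reflexive (sym (^-*-assoc 2 421 n)))
        (≤-trans (^-monoˡ-≤ n (≤ᵇ⇒≤ (2 ^ 421) (17 ^ 103) tt)) (≤-reflexive (^-swap 17 103 n)))

      C′ : ∀ q Q → Q ≡ suc q → 19 * q ≤ 6 * (H + d) + 18 → (33 ^ (L + q)) ^ 2 * 4 ^ Q ≤ 4 ^ H * (17 ^ H) ^ 3
      C′ q Q eq hi = ^-cancelʳ-≤ 45 (^-cancelʳ-≤ 103 (begin
        (((33 ^ n) ^ 2 * 4 ^ Q) ^ 45) ^ 103
          ≡⟨ cong (_^ 103) (trans (^-distribʳ-* 45 ((33 ^ n) ^ 2) (4 ^ Q)) (cong₂ _*_ (^-swap (33 ^ n) 2 45) (4^ (Q) 45))) ⟩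
        (((33 ^ n) ^ 45) ^ 2 * 2 ^ (Q * 90)) ^ 103
          ≤⟨ ^-monoˡ-≤ 103 (*-monoˡ-≤ (2 ^ (Q * 90)) (^-monoˡ-≤ 2 (33^n≤ n))) ⟩
        ((2 ^ (227 * n)) ^ 2 * 2 ^ (Q * 90)) ^ 103
          ≡⟨ cong (_^ 103) (trans (cong (_* 2 ^ (Q * 90)) (^-*-assoc 2 (227 * n) 2)) (sym (^-distribˡ-+-* 2 (227 * n * 2) (Q * 90)))) ⟩
        (2 ^ (227 * n * 2 + Q * 90)) ^ 103
          ≡⟨ ^-*-assoc 2 (227 * n * 2 + Q * 90) 103 ⟩
        2 ^ ((227 * n * 2 + Q * 90) * 103)
          ≤⟨ ^-monoʳ-≤ 2 exponents ⟩
        2 ^ (H * 90 * 103 + 421 * H * 3 * 45)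
          ≡⟨ ^-distribˡ-+-* 2 (H * 90 * 103) (421 * H * 3 * 45) ⟩
        2 ^ (H * 90 * 103) * 2 ^ (421 * H * 3 * 45)
          ≡⟨ cong₂ _*_ (sym (^-*-assoc 2 (H * 90) 103))
               (sym (trans (cong (_^ 45) (^-*-assoc 2 (421 * H) 3)) (^-*-assoc 2 (421 * H * 3) 45))) ⟩
        (2 ^ (H * 90)) ^ 103 * ((2 ^ (421 * H)) ^ 3) ^ 45
          ≤⟨ *-monoʳ-≤ ((2 ^ (H * 90)) ^ 103) (^-monoˡ-≤ 45 (^-monoˡ-≤ 3 (17^n≥ H))) ⟩
        (2 ^ (H * 90)) ^ 103 * (((17 ^ H) ^ 103) ^ 3) ^ 45
          ≡⟨ cong₂ (λ a b → a ^ 103 * b) (sym (4^ H 45)) (trans (cong (_^ 45) (^-swap (17 ^ H) 103 3)) (^-swap ((17 ^ H) ^ 3) 103 45)) ⟩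
        ((4 ^ H) ^ 45) ^ 103 * (((17 ^ H) ^ 3) ^ 45) ^ 103
          ≡⟨ trans (sym (^-distribʳ-* 103 ((4 ^ H) ^ 45) _)) (cong (_^ 103) (sym (^-distribʳ-* 45 (4 ^ H) _))) ⟩
        ((4 ^ H * (17 ^ H) ^ 3) ^ 45) ^ 103 ∎))
        where
        open ≤-Reasoning
        n = L + q
        4^ : ∀ m k → (4 ^ m) ^ k ≡ 2 ^ (m * (2 * k))
        4^ m k = trans (cong (_^ k) (^-*-assoc 2 2 m)) (trans (^-*-assoc 2 (2 * m) k) (cong (2 ^_) (l m k)))
          where
          l : ∀ m k → 2 * m * k ≡ m * (2 * k)
          l = solve-∀
        exponents : (227 * n * 2 + Q * 90) * 103 ≤ H * 90 * 103 + 421 * H * 3 * 45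
        exponents = begin
          (227 * (L + q) * 2 + Q * 90) * 103           ≡⟨ cong₂ (λ m r → (227 * (m + q) * 2 + r * 90) * 103) L≡H+d eq ⟩
          (227 * (H + d + q) * 2 + suc q * 90) * 103       ≡⟨ l 227 90 103 H d q ⟩
          46762 * H + (46762 * d + 56032 * q + 9270)       ≤⟨ +-monoʳ-≤ (46762 * H) (linear q hi) ⟩
          46762 * H + 19343 * H                            ≡⟨ trans (sym (*-distribʳ-+ H 46762 19343)) (sym (l′ 90 103 421 H)) ⟩
          H * 90 * 103 + 421 * H * 3 * 45                  ∎
          where
          l : ∀ a b c H d q → (a * (H + d + q) * 2 + suc q * b) * c ≡
            a * 2 * c * H + (a * 2 * c * d + (a * 2 * c + b * c) * q + b * c)
          l = solve-∀
          l′ : ∀ a b c H → H * a * b + c * H * 3 * 45 ≡ (a * b + c * 3 * 45) * H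
          l′ = solve-∀

    gap17-16 : ∀ U V φ δ .{{_ : NonZero V}} → Approach 16 1 H U V δ → V * φ ≡ 16 ^ L → ⊥
    gap17-16 U V φ δ app eq = go (ceiling (6 * L) 18)
      where
      at : ∀ q → 6 * L ≤ q * 19 → q * 19 ≤ 6 * L + 37 → Approximants.Offset 16 1 U V δ (q + d) → ⊥
      at zero lo hi off = n≮0 (≤-trans (≤-trans (s≤s z≤n) (≤-trans 900≤H (≤-trans (m≤m+n H d) (≤-trans (≤-reflexive (sym L≡H+d)) (m≤n*m L 6))))) lo)
      at (suc q) lo hi off = UnitGap.unit-gap-at 16 H L d L≡H+d U V φ δ app eq q q<H off
          (C (suc q) (≤-trans lo (≤-reflexive (*-comm (suc q) 19)))) (C′ q (suc q) refl hi′)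
        where
        open ≤-Reasoning
        hi′ : 19 * q ≤ 6 * (H + d) + 18
        hi′ = +-cancelˡ-≤ 19 _ _ (begin
          19 + 19 * q               ≡⟨ l₁ q ⟩
          suc q * 19                ≤⟨ hi ⟩
          6 * L + 37                ≡⟨ cong (λ n → 6 * n + 37) L≡H+d ⟩
          6 * (H + d) + 37          ≡⟨ l₂ (6 * (H + d)) ⟩
          19 + (6 * (H + d) + 18)   ∎)
          where
          l₁ : ∀ q → 19 + 19 * q ≡ suc q * 19
          l₁ = solve-∀
          l₂ : ∀ n → n + 37 ≡ 19 + (n + 18)
          l₂ = solve-∀
        q<H : suc q ≤ H
        q<H = ≰⇒> λ H≤q → <⇒≱ (≤-<-trans (linear q hi′) (*-monoˡ-< H {{>-nonZero (≤-trans (s≤s z≤n) 900≤H)}} (≤ᵇ⇒≤ 19344 56032 tt)))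
          (≤-trans (*-monoʳ-≤ 56032 H≤q) (≤-trans (m≤n+m (56032 * q) (46762 * d)) (m≤m+n _ 9270)))
      go : (∃ λ q → 6 * L ≤ q * 19 × q * 19 ≤ 6 * L + 18) → ⊥
      go (q , lo , hi) =
        [ at q lo (≤-trans hi (+-monoʳ-≤ (6 * L) (≤ᵇ⇒≤ 18 37 tt)))
        , at (suc q) (≤-trans lo (*-monoˡ-≤ 19 (n≤1+n q))) (≤-trans (+-monoʳ-≤ 19 hi) (≤-reflexive (l (6 * L))))
        ]′ (offset 16 1 (q + d) (Approach.direction app))
        where
        l : ∀ n → 19 + (n + 18) ≡ n + 37
        l = solve-∀

  -- Small exponents

  -- Bernoulli's inequality (lo/hi)ⁿ ≥ 1 - nδ/hi, cleared of denominators and subtraction.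
  bernoulli : ∀ n {lo hi δ} → lo ≤ hi → hi ≤ lo + δ → hi * hi ^ n ≤ hi * lo ^ n + n * δ * hi ^ n
  bernoulli zero    lo≤hi hi≤ = m≤m+n _ 0
  bernoulli (suc n) {lo} {hi} {δ} lo≤hi hi≤ = begin
    hi * (hi * hi ^ n)                                    ≤⟨ *-monoʳ-≤ hi (bernoulli n lo≤hi hi≤) ⟩
    hi * (hi * lo ^ n + n * δ * hi ^ n)                   ≡⟨ l₁ hi (lo ^ n) (n * δ) (hi ^ n) ⟩
    hi * lo ^ n * hi + n * δ * (hi * hi ^ n)              ≤⟨ +-monoˡ-≤ (n * δ * (hi * hi ^ n)) (*-monoʳ-≤ (hi * lo ^ n) hi≤) ⟩
    hi * lo ^ n * (lo + δ) + n * δ * (hi * hi ^ n)        ≡⟨ l₂ hi (lo ^ n) lo δ (n * δ * (hi * hi ^ n)) ⟩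
    hi * (lo * lo ^ n) + (δ * (hi * lo ^ n) + n * δ * (hi * hi ^ n))
      ≤⟨ +-monoʳ-≤ (hi * (lo * lo ^ n)) (+-monoˡ-≤ (n * δ * (hi * hi ^ n)) (*-monoʳ-≤ δ (*-monoʳ-≤ hi (^-monoˡ-≤ n lo≤hi)))) ⟩
    hi * (lo * lo ^ n) + (δ * (hi * hi ^ n) + n * δ * (hi * hi ^ n))
      ≡⟨ cong (hi * (lo * lo ^ n) +_) (sym (*-distribʳ-+ (hi * hi ^ n) δ (n * δ))) ⟩
    hi * (lo * lo ^ n) + (δ + n * δ) * (hi * hi ^ n)      ∎
    where
    open ≤-Reasoning
    l₁ : ∀ hi a b c → hi * (hi * a + b * c) ≡ hi * a * hi + b * (hi * c)
    l₁ = solve-∀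
    l₂ : ∀ hi a lo δ z → hi * a * (lo + δ) + z ≡ hi * (lo * a) + (δ * (hi * a) + z)
    l₂ = solve-∀

  -- The form used below: `b / a` bounds the loss nδ/hi, and `c / a` is what remains of 1.
  bernoulli-ratio : ∀ a b c n lo hi δ .{{_ : NonZero hi}} → lo ≤ hi → hi ≤ lo + δ →
    c + b ≡ a → a * (n * δ) ≤ b * hi → c * hi ^ n ≤ a * lo ^ n
  bernoulli-ratio a b c n lo hi δ lo≤hi hi≤ c+b≡a small =
    *-cancelˡ-≤ hi (+-cancelʳ-≤ (b * hi * hi ^ n) _ _ (begin
      hi * (c * hi ^ n) + b * hi * hi ^ n          ≡⟨ l₁ hi b c (hi ^ n) ⟩
      (c + b) * (hi * hi ^ n)                      ≡⟨ cong (_* (hi * hi ^ n)) c+b≡a ⟩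
      a * (hi * hi ^ n)                            ≤⟨ *-monoʳ-≤ a (bernoulli n lo≤hi hi≤) ⟩
      a * (hi * lo ^ n + n * δ * hi ^ n)           ≡⟨ l₂ a hi (lo ^ n) (n * δ) (hi ^ n) ⟩
      hi * (a * lo ^ n) + a * (n * δ) * hi ^ n     ≤⟨ +-monoʳ-≤ (hi * (a * lo ^ n)) (*-monoˡ-≤ (hi ^ n) small) ⟩
      hi * (a * lo ^ n) + b * hi * hi ^ n          ∎))
    where
    open ≤-Reasoning
    l₁ : ∀ hi b c z → hi * (c * z) + b * hi * z ≡ (c + b) * (hi * z)
    l₁ = solve-∀
    l₂ : ∀ a hi x y z → a * (hi * x + y * z) ≡ hi * (a * x) + a * y * z
    l₂ = solve-∀

  n≤n*n : ∀ n → n ≤ n * n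
  n≤n*n zero    = z≤n
  n≤n*n (suc n) = m≤m*n (suc n) (suc n)

  square-cancel-≤ : ∀ {x y} → x * x ≤ y * y → x ≤ y
  square-cancel-≤ {x} {y} le = ^-cancelʳ-≤ 2 (subst₂ _≤_ (l x) (l y) le)
    where
    l : ∀ x → x * x ≡ x * (x * 1)
    l = solve-∀

  quadratic≤2^ : ∀ c n₀ → 3 ≤ n₀ → c * (n₀ * n₀) ≤ 2 ^ n₀ → ∀ k → c * ((k + n₀) * (k + n₀)) ≤ 2 ^ (k + n₀)
  quadratic≤2^ c n₀ 3≤n₀ base zero    = base
  quadratic≤2^ c n₀ 3≤n₀ base (suc k) = begin
    c * (suc n * suc n)   ≤⟨ *-monoʳ-≤ c step ⟩
    c * (2 * (n * n))     ≡⟨ l c (n * n) ⟩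
    2 * (c * (n * n))     ≤⟨ *-monoʳ-≤ 2 (quadratic≤2^ c n₀ 3≤n₀ base k) ⟩
    2 * 2 ^ n             ∎
    where
    open ≤-Reasoning
    n = k + n₀
    l : ∀ c x → c * (2 * x) ≡ 2 * (c * x)
    l = solve-∀
    3≤n : 3 ≤ n
    3≤n = ≤-trans 3≤n₀ (m≤n+m n₀ k)
    step : suc n * suc n ≤ 2 * (n * n)
    step = begin
      suc n * suc n           ≡⟨ l₁ n ⟩
      n * n + (2 * n + 1)     ≤⟨ +-monoʳ-≤ (n * n) (+-monoʳ-≤ (2 * n) (≤-trans (s≤s z≤n) 3≤n)) ⟩
      n * n + (2 * n + n)     ≡⟨ l₂ n ⟩
      n * n + 3 * n           ≤⟨ +-monoʳ-≤ (n * n) (*-monoˡ-≤ n 3≤n) ⟩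
      n * n + n * n           ≡⟨ l₃ (n * n) ⟩
      2 * (n * n)             ∎
      where
      l₁ : ∀ n → suc n * suc n ≡ n * n + (2 * n + 1)
      l₁ = solve-∀
      l₂ : ∀ n → n * n + (2 * n + n) ≡ n * n + 3 * n
      l₂ = solve-∀
      l₃ : ∀ x → x + x ≡ 2 * x
      l₃ = solve-∀

  -- Two lower bounds for `X` share the work: `M` up to `n₀`, and `2 ^ n` beyond it.
  quadratic≤ : ∀ c n₀ M {n X} → 3 ≤ n₀ → c * (n₀ * n₀) ≤ 2 ^ n₀ → c * (n₀ * n₀) ≤ M →
    2 ^ n ≤ X → M ≤ X → c * (n * n) ≤ X
  quadratic≤ c n₀ M {n} {X} 3≤n₀ base base′ 2^n≤X M≤X with ≤-total n n₀
  ... | inj₁ n≤n₀ = ≤-trans (*-monoʳ-≤ c (*-mono-≤ n≤n₀ n≤n₀)) (≤-trans base′ M≤X)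
  ... | inj₂ n₀≤n = ≤-trans (subst (λ m → c * (m * m) ≤ 2 ^ m) (m∸n+n≡m n₀≤n)
                              (quadratic≤2^ c n₀ 3≤n₀ base (n ∸ n₀))) 2^n≤X

  -- A symmetric weakening of `Close`: with 15 in place of 16 the bound on `δ` holds relative to
  -- both numbers, so they can be exchanged.
  record Near (U V δ : ℕ) : Set where
    field
      direction : U ≡ V + δ ⊎ V ≡ U + δ
      δ²<U : 15 * (δ * δ) < U
      δ²<V : 15 * (δ * δ) < V
      U≤V : 15 * U ≤ 16 * V
      V≤U : 15 * V ≤ 16 * U

  near-sym : ∀ {U V δ} → Near U V δ → Near V U δ
  near-sym n = record { direction = [ inj₂ , inj₁ ]′ direction ; δ²<U = δ²<V ; δ²<V = δ²<U ; U≤V = V≤U ; V≤U = U≤V }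
    where open Near n

  ordered⇒near : ∀ {U V} → U ≤ V → 16 * ((V ∸ U) * (V ∸ U)) < V → Near U V (V ∸ U)
  ordered⇒near {U} {V} U≤V c = record
    { direction = inj₂ V≡U+δ
    ; δ²<U = δ²<U
    ; δ²<V = <-≤-trans δ²<U U≤V
    ; U≤V = *-mono-≤ {15} {16} (≤ᵇ⇒≤ 15 16 tt) U≤V
    ; V≤U = begin
        15 * V                   ≡⟨ cong (15 *_) V≡U+δ ⟩
        15 * (U + δ)             ≡⟨ *-distribˡ-+ 15 U δ ⟩
        15 * U + 15 * δ          ≤⟨ +-monoʳ-≤ (15 * U) (≤-trans (*-monoʳ-≤ 15 (n≤n*n δ)) (<⇒≤ δ²<U)) ⟩
        15 * U + U               ≡⟨ +-comm (15 * U) U ⟩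
        16 * U                   ∎
    }
    where
    open ≤-Reasoning
    δ = V ∸ U
    V≡U+δ : V ≡ U + δ
    V≡U+δ = sym (m+[n∸m]≡n U≤V)
    -- Since `δ ≤ δ * δ`, one of the sixteen squares pays for passing from `V` to `U`.
    δ²<U : 15 * (δ * δ) < U
    δ²<U = +-cancelˡ-< (δ * δ) _ _ (begin-strict
      16 * (δ * δ)     <⟨ c ⟩
      V                ≡⟨ V≡U+δ ⟩
      U + δ            ≤⟨ +-monoʳ-≤ U (n≤n*n δ) ⟩
      U + δ * δ        ≡⟨ +-comm U (δ * δ) ⟩
      δ * δ + U        ∎)

  close⇒near : ∀ {U V} → Close U V → ∃ (Near U V)
  close⇒near {U} {V} (c , c′) with ≤-total U V
  ... | inj₁ U≤V = V ∸ U , ordered⇒near U≤V c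
  ... | inj₂ V≤U = U ∸ V , near-sym (ordered⇒near V≤U c′)

  -- Distinct powers with this exponent differ by at least `e ^ suc n`, and the square of that is at
  -- least `e ^ suc (suc n)`.
  power-gap : ∀ n e f → f < e → e ^ suc (suc n) ≤ 16 * ((e ^ suc (suc n) ∸ f ^ suc (suc n)) * (e ^ suc (suc n) ∸ f ^ suc (suc n)))
  power-gap n (suc e) f (s≤s f≤e) = begin
    E * (E * E ^ n)                        ≤⟨ *-monoʳ-≤ E (*-monoʳ-≤ E (m≤m*n (E ^ n) (E ^ n) {{m^n≢0 E n}})) ⟩
    E * (E * (E ^ n * E ^ n))              ≡⟨ l E (E ^ n) ⟩
    z * z                                  ≤⟨ *-mono-≤ z≤ z≤ ⟩
    g * g                                  ≤⟨ m≤n*m (g * g) 16 ⟩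
    16 * (g * g)                           ∎
    where
    open ≤-Reasoning
    E = suc e
    z = E ^ suc n
    g = E ^ suc (suc n) ∸ f ^ suc (suc n)
    l : ∀ E x → E * (E * (x * x)) ≡ E * x * (E * x)
    l = solve-∀
    z≤ : z ≤ g
    z≤ = m+n≤o⇒m≤o∸n z (+-monoʳ-≤ z (*-mono-≤ f≤e (^-monoˡ-≤ (suc n) (≤-trans f≤e (n≤1+n e)))))

  power-close : ∀ n {U V δ} → Near U V δ → 6 * (n * n) ≤ V → 8 * V ^ n ≤ 9 * U ^ n
  power-close n {U} {V} {δ} near 6n²≤V with ≤-total V U
  ... | inj₁ V≤U = *-mono-≤ {8} {9} (≤ᵇ⇒≤ 8 9 tt) (^-monoˡ-≤ n V≤U)
  ... | inj₂ U≤V = bernoulli-ratio 9 1 8 n U V δ {{>-nonZero (≤-<-trans z≤n δ²<V)}} U≤V V≤U+δ refl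
      (square-cancel-≤ (begin
        9 * (n * δ) * (9 * (n * δ))                  ≤⟨ m≤m+n _ (9 * (n * δ * (n * δ))) ⟩
        9 * (n * δ) * (9 * (n * δ)) + 9 * (n * δ * (n * δ)) ≡⟨ l n δ ⟩
        6 * (n * n) * (15 * (δ * δ))                 ≤⟨ *-mono-≤ 6n²≤V (<⇒≤ δ²<V) ⟩
        V * V                                        ≡⟨ cong (λ x → x * x) (sym (*-identityˡ V)) ⟩
        1 * V * (1 * V)                              ∎))
    where
    open ≤-Reasoning
    open Near near using (direction; δ²<V)
    V≤U+δ : V ≤ U + δ
    V≤U+δ = [ (λ eq → ≤-trans (m≤m+n V δ) (≤-trans (≤-reflexive (sym eq)) (m≤m+n U δ))) , ≤-reflexive ]′ direction
    l : ∀ n δ → 9 * (n * δ) * (9 * (n * δ)) + 9 * (n * δ * (n * δ)) ≡ 6 * (n * n) * (15 * (δ * δ))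
    l = solve-∀

  -- Comparison of the exponents of two close pairs of powers

  record Configuration (e f α β u w : ℕ) : Set where
    X = e ^ α
    Y = f ^ β
    U = e ^ u
    V = f ^ w
    η = X ∸ Y
    field
      2≤e : 2 ≤ e
      2≤f : 2 ≤ f
      1≤α : 1 ≤ α
      1≤β : 1 ≤ β
      α<u : α < u
      β<w : β < w
      Y<X : Y < X
      gap : 16 * (η * η) < X
      close : Close U V
      coprime₁ : Coprime α u
      coprime₂ : Coprime β w

  module Analysis {e f α β u w : ℕ} (C : Configuration e f α β u w) where
    open Configuration C public

    instance
      e≢0 : NonZero e
      e≢0 = >-nonZero (≤-trans (s≤s z≤n) 2≤e)
    instance
      f≢0 : NonZero f
      f≢0 = >-nonZero (≤-trans (s≤s z≤n) 2≤f)
    instance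
      α≢0 : NonZero α
      α≢0 = >-nonZero 1≤α
    instance
      β≢0 : NonZero β
      β≢0 = >-nonZero 1≤β
    instance
      X≢0 : NonZero X
      X≢0 = m^n≢0 e α
    instance
      Y≢0 : NonZero Y
      Y≢0 = m^n≢0 f β
    instance
      V≢0 : NonZero V
      V≢0 = m^n≢0 f w
    instance
      η≢0 : NonZero η
      η≢0 = >-nonZero (m<n⇒0<n∸m Y<X)

    δ : ℕ
    δ = proj₁ (close⇒near close)
    near : Near U V δ
    near = proj₂ (close⇒near close)

    Y+η≡X : Y + η ≡ X
    Y+η≡X = m+[n∸m]≡n (<⇒≤ Y<X)

    2^α≤X : 2 ^ α ≤ X
    2^α≤X = ^-monoˡ-≤ α 2≤e

    2^β≤X : 2 ^ β ≤ X
    2^β≤X = ≤-trans (^-monoˡ-≤ β 2≤f) (<⇒≤ Y<X)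

    -- (mη)² = k · 16η² ≤ X² when m² = 16k.
    scaled-gap : ∀ m k → m * m ≡ 16 * k → k ≤ X → m * η ≤ X
    scaled-gap m k m²≡16k k≤X = square-cancel-≤ (begin
      m * η * (m * η)        ≡⟨ l₁ m η ⟩
      m * m * (η * η)        ≡⟨ cong (_* (η * η)) m²≡16k ⟩
      16 * k * (η * η)       ≡⟨ l₂ k (η * η) ⟩
      k * (16 * (η * η))     ≤⟨ *-mono-≤ k≤X (<⇒≤ gap) ⟩
      X * X                  ∎)
      where
      open ≤-Reasoning
      l₁ : ∀ m η → m * η * (m * η) ≡ m * m * (η * η)
      l₁ = solve-∀
      l₂ : ∀ k x → 16 * k * x ≡ k * (16 * x)
      l₂ = solve-∀

    ratio : ∀ a b c n → c + b ≡ a → a * (n * η) ≤ b * X → c * X ^ n ≤ a * Y ^ n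
    ratio a b c n = bernoulli-ratio a b c n Y X η (<⇒≤ Y<X) (≤-reflexive (sym Y+η≡X))

    X≤U : X ≤ U
    X≤U = ^-monoʳ-≤ e (<⇒≤ α<u)

    16<X : 16 < X
    16<X = ≤-<-trans (*-monoʳ-≤ 16 (*-mono-≤ (>-nonZero⁻¹ η) (>-nonZero⁻¹ η))) gap

    X≤V : X ≤ V
    X≤V = *-cancelˡ-≤ 16 (begin
      16 * X            ≡⟨ cong (16 *_) (sym Y+η≡X) ⟩
      16 * (Y + η)      ≡⟨ *-distribˡ-+ 16 Y η ⟩
      16 * Y + 16 * η   ≤⟨ +-monoʳ-≤ (16 * Y) (*-monoʳ-≤ 16 η≤Y) ⟩
      16 * Y + 16 * Y   ≡⟨ l Y ⟩
      16 * (2 * Y)      ≤⟨ *-monoʳ-≤ 16 (*-monoˡ-≤ Y 2≤f) ⟩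
      16 * (f * Y)      ≤⟨ *-monoʳ-≤ 16 (^-monoʳ-≤ f β<w) ⟩
      16 * V            ∎)
      where
      open ≤-Reasoning
      l : ∀ Y → 16 * Y + 16 * Y ≡ 16 * (2 * Y)
      l = solve-∀
      η≤Y : η ≤ Y
      η≤Y = +-cancelʳ-≤ η _ _ (begin
        η + η               ≤⟨ ≤-trans (≤-reflexive (l′ η)) (*-monoʳ-≤ 2 (n≤n*n η)) ⟩
        2 * (η * η)         ≤⟨ *-monoˡ-≤ (η * η) (≤ᵇ⇒≤ 2 16 tt) ⟩
        16 * (η * η)        ≤⟨ <⇒≤ gap ⟩
        X                   ≡⟨ sym Y+η≡X ⟩
        Y + η               ∎)
        where
        l′ : ∀ η → η + η ≡ 2 * η
        l′ = solve-∀

    equal-exponents : α ≡ β → ¬ (2 ≤ α)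
    equal-exponents refl (s≤s (s≤s {n = k} _)) = <⇒≱ gap
      (power-gap k e f (^-cancelʳ-< (suc (suc k)) Y<X))

    -- `power-gap` needs an exponent of at least 2. If `α` is 1, it is applied to `U` and `V`
    -- instead, since `u` is then at least 2.
    equal-ratios : α ≡ β → u ≡ w → ⊥
    equal-ratios refl refl = go α u refl refl
      where
      go : ∀ a v → α ≡ a → u ≡ v → ⊥
      go zero          v             refl _    = n≮0 1≤α
      go (suc (suc k)) v             refl _    = equal-exponents refl (s≤s (s≤s z≤n))
      go (suc zero)    zero          refl refl = n≮0 α<u
      go (suc zero)    (suc zero)    refl refl = n≮n 1 α<u
      go (suc zero)    (suc (suc k)) refl refl = <⇒≱ (proj₂ close) (power-gap k e f (^-cancelʳ-< 1 Y<X))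

    coprime-ratios : w * α ≡ u * β → ⊥
    coprime-ratios eq = equal-ratios α≡β u≡w
      where
      α∣β : α ∣ β
      α∣β = coprime-divisor coprime₁ (divides w (sym eq))
      β∣α : β ∣ α
      β∣α = coprime-divisor coprime₂ (divides u eq)
      α≡β : α ≡ β
      α≡β = ∣-antisym α∣β β∣α
      u≡w : u ≡ w
      u≡w = *-cancelʳ-≡ u w β (trans (sym eq) (cong (w *_) α≡β))

    -- If w/β ≤ u/α, then U is too large compared with V; otherwise the quotient (X/Y)ᵘ exceeds about f.
    f*Y^u≤ : 6 * (α * α) ≤ X → 6 * (β * β) ≤ X → 8 * (f * Y ^ u) ≤ 9 * X ^ u
    f*Y^u≤ 6α²≤X 6β²≤X with <-cmp (w * α) (u * β)
    ... | tri≈ _ eq _ = ⊥-elim (coprime-ratios eq)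
    -- The strict inequality of integers gains a whole factor `e`, which outweighs the 9/8 lost in
    -- comparing `U ^ β` with `V ^ β`.
    ... | tri< lt _ _ = ⊥-elim (<⇒≱ (*-monoˡ-< (X ^ w) {{m^n≢0 X w}} (≤ᵇ⇒≤ 10 16 tt)) (begin
      16 * X ^ w              ≡⟨ *-assoc 8 2 (X ^ w) ⟩
      8 * (2 * X ^ w)         ≤⟨ *-monoʳ-≤ 8 (*-monoˡ-≤ (X ^ w) 2≤e) ⟩
      8 * (e * X ^ w)         ≡⟨ cong (λ x → 8 * (e * x)) (trans (^-*-assoc e α w) (cong (e ^_) (*-comm α w))) ⟩
      8 * e ^ suc (w * α)     ≤⟨ *-monoʳ-≤ 8 (^-monoʳ-≤ e lt) ⟩
      8 * e ^ (u * β)         ≡⟨ cong (8 *_) (sym (^-*-assoc e u β)) ⟩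
      8 * U ^ β               ≤⟨ power-close β (near-sym near) (≤-trans 6β²≤X X≤U) ⟩
      9 * V ^ β               ≡⟨ cong (9 *_) (^-swap f w β) ⟩
      9 * Y ^ w               ≤⟨ *-monoʳ-≤ 9 (^-monoˡ-≤ w (<⇒≤ Y<X)) ⟩
      9 * X ^ w               ∎))
      where open ≤-Reasoning
    ... | tri> _ _ gt = begin
      8 * (f * Y ^ u)         ≡⟨ cong (λ x → 8 * (f * x)) (trans (^-*-assoc f β u) (cong (f ^_) (*-comm β u))) ⟩
      8 * f ^ suc (u * β)     ≤⟨ *-monoʳ-≤ 8 (^-monoʳ-≤ f gt) ⟩
      8 * f ^ (w * α)         ≡⟨ cong (8 *_) (sym (^-*-assoc f w α)) ⟩
      8 * V ^ α               ≤⟨ power-close α near (≤-trans 6α²≤X X≤V) ⟩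
      9 * U ^ α               ≡⟨ cong (9 *_) (^-swap e u α) ⟩
      9 * X ^ u               ∎
      where open ≤-Reasoning

    f*Y^n≤ : 6 * (α * α) ≤ X → 6 * (β * β) ≤ X → ∀ n → u ≤ n → 8 * (f * Y ^ n) ≤ 9 * X ^ n
    f*Y^n≤ 6α²≤X 6β²≤X n u≤n = begin
      8 * (f * Y ^ n)                   ≡⟨ cong (λ x → 8 * (f * x)) (split Y) ⟩
      8 * (f * (Y ^ u * Y ^ (n ∸ u)))   ≡⟨ l f (Y ^ u) (Y ^ (n ∸ u)) ⟩
      8 * (f * Y ^ u) * Y ^ (n ∸ u)     ≤⟨ *-mono-≤ (f*Y^u≤ 6α²≤X 6β²≤X) (^-monoˡ-≤ (n ∸ u) (<⇒≤ Y<X)) ⟩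
      9 * X ^ u * X ^ (n ∸ u)           ≡⟨ *-assoc 9 (X ^ u) (X ^ (n ∸ u)) ⟩
      9 * (X ^ u * X ^ (n ∸ u))         ≡⟨ cong (9 *_) (sym (split X)) ⟩
      9 * X ^ n                         ∎
      where
      open ≤-Reasoning
      split : ∀ x → x ^ n ≡ x ^ u * x ^ (n ∸ u)
      split x = trans (cong (x ^_) (sym (m+[n∸m]≡n u≤n))) (^-distribˡ-+-* x u (n ∸ u))
      l : ∀ f a b → 8 * (f * (a * b)) ≡ 8 * (f * a) * b
      l = solve-∀

  -- Conclusion for powers

  <ᵇ-true : ∀ {m n} → m < n → (m <ᵇ n) ≡ true
  <ᵇ-true {m} {n} m<n with m <ᵇ n in eq
  ... | true  = refl
  ... | false = ⊥-elim (subst T eq (<⇒<ᵇ m<n))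

  <ᵇ-false : ∀ {m n} → n ≤ m → (m <ᵇ n) ≡ false
  <ᵇ-false {m} {n} n≤m with m <ᵇ n in eq
  ... | true  = ⊥-elim (<⇒≱ (<ᵇ⇒< m n (subst T (sym eq) tt)) n≤m)
  ... | false = refl

  bound-900 : ∀ {X} → X < 65 → bound X ≡ 900
  bound-900 X<65 rewrite <ᵇ-true X<65 = refl

  bound-123 : ∀ {X} → 65 ≤ X → X < 256 → bound X ≡ 123
  bound-123 65≤X X<256 rewrite <ᵇ-false 65≤X | <ᵇ-true X<256 = refl

  bound-52 : ∀ {X} → 256 ≤ X → bound X ≡ 52
  bound-52 256≤X rewrite <ᵇ-false (≤-trans (≤ᵇ⇒≤ 65 256 tt) 256≤X) | <ᵇ-false 256≤X = refl

  -- `X ^ a ≤ Y ^ b` stands for log X / log Y ≤ b/a, so no logarithm has to be defined.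
  exponent-< : ∀ X Y a b l n → 1 < X → X ^ a ≤ Y ^ b → Y ^ l < X ^ n → .{{_ : NonZero b}} → a * l < b * n
  exponent-< X Y a b l n 1<X X^a≤Y^b Y^l<X^n = ≰⇒> λ bn≤al → <⇒≱ (begin-strict
    (Y ^ l) ^ b       <⟨ ^-monoˡ-< b Y^l<X^n ⟩
    (X ^ n) ^ b       ≡⟨ trans (^-*-assoc X n b) (cong (X ^_) (*-comm n b)) ⟩
    X ^ (b * n)       ∎)
    (begin
    X ^ (b * n)       ≤⟨ ^-monoʳ-≤ X {{>-nonZero (<-trans (s≤s z≤n) 1<X)}} bn≤al ⟩
    X ^ (a * l)       ≡⟨ sym (^-*-assoc X a l) ⟩
    (X ^ a) ^ l       ≤⟨ ^-monoˡ-≤ l X^a≤Y^b ⟩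
    (Y ^ b) ^ l       ≡⟨ ^-swap Y b l ⟩
    (Y ^ l) ^ b       ∎)
    where open ≤-Reasoning

  excess-≤ : ∀ a H d l → l + 1 ≡ H + d → a * l < suc a * (H + 1) → a * d ≤ H + (a + a)
  excess-≤ a H d l eq lt = +-cancelˡ-≤ (a * H) _ _ (s≤s⁻¹ (begin-strict
    a * H + a * d                     ≡⟨ sym (*-distribˡ-+ a H d) ⟩
    a * (H + d)                       ≡⟨ cong (a *_) (sym eq) ⟩
    a * (l + 1)                       ≡⟨ l₁ a l ⟩
    a * l + a                         <⟨ +-monoˡ-< a lt ⟩
    suc a * (H + 1) + a               ≡⟨ l₂ a H ⟩
    suc (a * H + (H + (a + a)))       ∎))
    where
    open ≤-Reasoning
    l₁ : ∀ a l → a * (l + 1) ≡ a * l + a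
    l₁ = solve-∀
    l₂ : ∀ a H → suc a * (H + 1) + a ≡ suc (a * H + (H + (a + a)))
    l₂ = solve-∀

  -- The bound 50/49 for log(Y + 1) / log Y holds from 17 on but not at 16, where 46/45 takes its
  -- place.
  ratio₄₉ : ℕ → Bool
  ratio₄₉ Y = if 17 ≤ᵇ Y then (Y + 1) ^ 49 ≤ᵇ Y ^ 50 else true

  ratio₄₉-check : T (all< 64 ratio₄₉)
  ratio₄₉-check = tt

  ratio₄₉-sound : ∀ Y → 17 ≤ Y → Y < 64 → (Y + 1) ^ 49 ≤ Y ^ 50
  ratio₄₉-sound Y 17≤Y Y<64 = go (all<-sound 64 ratio₄₉ ratio₄₉-check Y<64)
    where
    go : T (ratio₄₉ Y) → (Y + 1) ^ 49 ≤ Y ^ 50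
    go t with 17 ≤ᵇ Y in eq
    ... | true  = ≤ᵇ⇒≤ _ _ t
    ... | false = ⊥-elim (subst T eq (≤⇒≤ᵇ 17≤Y))

  small-X : ∀ Y H l d U V φ δ .{{_ : NonZero V}} → 16 ≤ Y → Y < 64 → 900 ≤ H → Approach Y 1 H U V δ →
    V * φ ≡ Y ^ (l + 1) → l + 1 ≡ H + d → Y ^ l < (Y + 1) ^ (H + 1) → ⊥
  small-X Y H l d U V φ δ 16≤Y Y<64 900≤H app eq L≡H+d Y^l< with Y ≟ 16
  ... | yes refl = Gap17-16.gap17-16 H (l + 1) d L≡H+d 900≤H
    (excess-≤ 45 H d l L≡H+d (exponent-< 17 16 45 46 l (H + 1) (≤ᵇ⇒≤ 2 17 tt) (≤ᵇ⇒≤ (17 ^ 45) (16 ^ 46) tt) Y^l<))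
    U V φ δ app eq
  ... | no Y≢16 = UnitGap.unit-gap Y H (l + 1) d L≡H+d {{>-nonZero (≤-trans (s≤s z≤n) 16≤Y)}}
    (≤-trans (≤ᵇ⇒≤ (4 ^ 25) (18 ^ 12) tt) (^-monoˡ-≤ 12 18≤X)) 18≤X 900≤H
    (excess-≤ 49 H d l L≡H+d (exponent-< (Y + 1) Y 49 50 l (H + 1) (≤-trans (≤ᵇ⇒≤ 2 18 tt) 18≤X) (ratio₄₉-sound Y 17≤Y Y<64) Y^l<))
    U V φ δ app eq
    where
    17≤Y : 17 ≤ Y
    17≤Y = ≤∧≢⇒< 16≤Y (λ eq → Y≢16 (sym eq))
    18≤X : 18 ≤ Y + 1
    18≤X = +-monoˡ-≤ 1 17≤Y

  separated-powers : ∀ H e f α β u w .{{_ : NonZero e}} .{{_ : NonZero f}} → T (separated H e f (e ^ α) (f ^ β)) →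
    f ^ β < e ^ α → 16 * ((e ^ α ∸ f ^ β) * (e ^ α ∸ f ^ β)) < e ^ α → α < u → β < w →
    e ^ u < (e ^ α) ^ H → ¬ Close (e ^ u) (f ^ w)
  separated-powers H e f α β u w t Y<X gap α<u β<w =
    subst₂ (λ U V → U < (e ^ α) ^ H → ¬ Close U V) (shift e α u α<u) (shift f β w β<w)
      (separated-sound H e f (e ^ α) (f ^ β) t Y<X gap (u ∸ suc α) (w ∸ suc β))
    where
    shift : ∀ x m n → m < n → x ^ (n ∸ suc m) * (x * x ^ m) ≡ x ^ n
    shift x m n m<n = trans (sym (^-distribˡ-+-* x (n ∸ suc m) (suc m))) (cong (x ^_) (m∸n+n≡m m<n))

  exponent<11 : ∀ k x → 2 ≤ x → x ^ k < 1600 → k < 11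
  exponent<11 k x 2≤x x^k< = ≰⇒> λ 11≤k →
    <⇒≱ x^k< (≤-trans (≤ᵇ⇒≤ 1600 (2 ^ 11) tt) (≤-trans (^-monoʳ-≤ 2 11≤k) (^-monoˡ-≤ k 2≤x)))

  exponent<19 : ∀ k x → 2 ≤ x → x ^ k < 2 ^ 19 → k < 19
  exponent<19 k x 2≤x x^k< = ≰⇒> λ 19≤k → <⇒≱ x^k< (≤-trans (^-monoʳ-≤ 2 19≤k) (^-monoˡ-≤ k 2≤x))

  separated₁₁ : ∀ X η → X < 256 → η < 3 → T (separated (bound X) X (X ∸ suc η) X (X ∸ suc η))
  separated₁₁ X η X<256 η<3 =
    (all<-sound 3 (λ η → sep₁₁ X (X ∸ suc η)) (all<-sound 256 all₁₁ check₁₁ X<256) η<3)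

  separatedX : ∀ e α X η → X ≡ e ^ (2 + α) → 2 ≤ e → X < 1600 → η < 9 →
    T (separated (bound X) e (X ∸ suc η) X (X ∸ suc η))
  separatedX e α X η refl 2≤e X<1600 η<9 =
    (all<-sound 9 (λ η → separated (bound X) e (X ∸ suc η) X (X ∸ suc η)) row η<9)
    where
    row : T (sepX e (e ^ (2 + α)))
    row = powers-sound 1600 (2 + α) sepX
      (all<-sound 9 allX checkX (+-cancelˡ-< 2 _ _ (exponent<11 (2 + α) e 2≤e X<1600))) 2≤e X<1600

  separatedY : ∀ f β Y η → Y ≡ f ^ (2 + β) → 2 ≤ f → Y < 1600 → η < 9 →
    T (separated (bound (Y + suc η)) (Y + suc η) f (Y + suc η) Y)
  separatedY f β Y η refl 2≤f Y<1600 η<9 =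
    (all<-sound 9 (λ η → separated (bound (Y + suc η)) (Y + suc η) f (Y + suc η) Y) row η<9)
    where
    row : T (sepY f (f ^ (2 + β)))
    row = powers-sound 1600 (2 + β) sepY
      (all<-sound 9 allY checkY (+-cancelˡ-< 2 _ _ (exponent<11 (2 + β) f 2≤f Y<1600))) 2≤f Y<1600

  separatedXY : ∀ e α f β X Y → X ≡ e ^ (3 + α) → Y ≡ f ^ (2 + β) → 2 ≤ e → 2 ≤ f → X < 2 ^ 19 → Y < 2 ^ 19 →
    T (separated (bound X) e f X Y) × T (separated (bound Y) f e Y X)
  separatedXY e α f β X Y refl refl 2≤e 2≤f X< Y< =
    (T-∧ˡ {separated (bound X) e f X Y} {separated (bound Y) f e Y X} pair) ,
    (T-∧ʳ {separated (bound X) e f X Y} {separated (bound Y) f e Y X} pair)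
    where
    row : T (rowXY e X)
    row = powers-sound (2 ^ 19) (3 + α) rowXY
      (all<-sound 16 allXY checkXY (+-cancelˡ-< 3 _ _ (exponent<19 (3 + α) e 2≤e X<))) 2≤e X<
    pair : T (sepXY e X f Y)
    pair = powers-sound (2 ^ 19) (2 + β) (sepXY e X)
      (all<-sound 17 (cellXY e X) row (+-cancelˡ-< 2 _ _ (exponent<19 (2 + β) f 2≤f Y<))) 2≤f Y<

  module Conclusion {e f α β u w : ℕ} (C : Configuration e f α β u w) where
    open Analysis C

    H : ℕ
    H = u / α

    Hα≤u : H * α ≤ u
    Hα≤u = m/n*n≤m u α

    u<[1+H]α : u < suc H * α
    u<[1+H]α = begin-strict
      u                  ≡⟨ m≡m%n+[m/n]*n u α ⟩
      u % α + H * α      <⟨ +-monoˡ-< (H * α) (m%n<n u α) ⟩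
      α + H * α          ∎
      where open ≤-Reasoning

    X^n≡ : ∀ n → X ^ n ≡ e ^ (n * α)
    X^n≡ n = trans (^-*-assoc e α n) (cong (e ^_) (*-comm α n))

    Y^n≡ : ∀ n → Y ^ n ≡ f ^ (n * β)
    Y^n≡ n = trans (^-*-assoc f β n) (cong (f ^_) (*-comm β n))

    X^H≤U : X ^ H ≤ U
    X^H≤U = ≤-trans (≤-reflexive (X^n≡ H)) (^-monoʳ-≤ e Hα≤u)

    approach : Approach Y η H U V δ
    approach = record
      { direction = Near.direction near
      ; 15δ²<V = Near.δ²<V near
      ; X^H∣U = subst (λ x → x ^ H ∣ U) (sym Y+η≡X) (divides (e ^ (u ∸ H * α)) (begin
          U                              ≡⟨ cong (e ^_) (sym (m∸n+n≡m Hα≤u)) ⟩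
          e ^ (u ∸ H * α + H * α)        ≡⟨ ^-distribˡ-+-* e (u ∸ H * α) (H * α) ⟩
          e ^ (u ∸ H * α) * e ^ (H * α)  ≡⟨ cong (e ^ (u ∸ H * α) *_) (sym (X^n≡ H)) ⟩
          e ^ (u ∸ H * α) * X ^ H        ∎))
      ; X^H≤V = subst (λ x → 15 * x ^ H ≤ 16 * V) (sym Y+η≡X) (≤-trans (*-monoʳ-≤ 15 X^H≤U) (Near.U≤V near))
      }
      where open ≡-Reasoning

    V≤X^[1+H] : ∀ N → N ≡ suc H → V ≤ X ^ N
    V≤X^[1+H] N refl = *-cancelˡ-≤ 15 (begin
      15 * V           ≤⟨ Near.V≤U near ⟩
      16 * U           ≤⟨ *-monoˡ-≤ U (≤ᵇ⇒≤ 16 30 tt) ⟩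
      30 * U           ≡⟨ *-assoc 15 2 U ⟩
      15 * (2 * U)     ≤⟨ *-monoʳ-≤ 15 (*-monoˡ-≤ U 2≤e) ⟩
      15 * e ^ suc u   ≤⟨ *-monoʳ-≤ 15 (^-monoʳ-≤ e u<[1+H]α) ⟩
      15 * e ^ (N * α) ≡⟨ cong (15 *_) (sym (X^n≡ N)) ⟩
      15 * X ^ N       ∎)
      where open ≤-Reasoning

    U<X^n : ∀ n → H < n → U < X ^ n
    U<X^n n H<n = <-≤-trans (^-monoʳ-< e 2≤e (<-≤-trans u<[1+H]α (*-monoˡ-≤ α H<n))) (≤-reflexive (sym (X^n≡ n)))

    finite : T (separated (bound X) e f X Y) → U < X ^ bound X → ⊥
    finite t U< = separated-powers (bound X) e f α β u w t Y<X gap α<u β<w U< close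

    η<4 : X < 256 → η < 4
    η<4 X<256 = ≰⇒> λ 4≤η → <⇒≱ (<-trans gap X<256) (*-monoʳ-≤ 16 (*-mono-≤ 4≤η 4≤η))

    η<10 : X < 1600 → η < 10
    η<10 X<1600 = ≰⇒> λ 10≤η → <⇒≱ (<-trans gap X<1600) (*-monoʳ-≤ 16 (*-mono-≤ 10≤η 10≤η))

    1+pred-η : suc (pred η) ≡ η
    1+pred-η = suc-pred η

    X∸η≡Y : X ∸ suc (pred η) ≡ Y
    X∸η≡Y = trans (cong (X ∸_) 1+pred-η) (m∸[m∸n]≡n (<⇒≤ Y<X))

    Y+1+pred-η≡X : Y + suc (pred η) ≡ X
    Y+1+pred-η≡X = trans (cong (Y +_) 1+pred-η) Y+η≡X

    pred-η< : ∀ {n} → η < suc n → pred η < n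
    pred-η< {n} η<1+n = s≤s⁻¹ (subst (_< suc n) (sym 1+pred-η) η<1+n)

    private
      2+_∸2 : ∀ {n} → 2 ≤ n → 2 + (n ∸ 2) ≡ n
      2+_∸2 = m+[n∸m]≡n
      3+_∸3 : ∀ {n} → 3 ≤ n → 3 + (n ∸ 3) ≡ n
      3+_∸3 = m+[n∸m]≡n

    small-case₁₁ : α ≡ 1 → β ≡ 1 → X < 256 → T (separated (bound X) e f X Y)
    small-case₁₁ refl refl X<256 =
      subst₂ (λ e′ f′ → T (separated (bound X) e′ f′ X Y)) (^-identityʳ e) (^-identityʳ f)
        (subst (λ y → T (separated (bound X) X y X y)) X∸η≡Y (separated₁₁ X (pred η) X<256 (pred-η< (η<4 X<256))))

    small-caseX : 2 ≤ α → β ≡ 1 → X < 1600 → T (separated (bound X) e f X Y)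
    small-caseX 2≤α refl X<1600 =
      subst (λ f′ → T (separated (bound X) e f′ X Y)) (^-identityʳ f)
        (subst (λ y → T (separated (bound X) e y X y)) X∸η≡Y
          (separatedX e (α ∸ 2) X (pred η) (cong (e ^_) (sym (2+_∸2 2≤α))) 2≤e X<1600 (pred-η< (η<10 X<1600))))

    small-caseY : α ≡ 1 → 2 ≤ β → X < 1600 → T (separated (bound X) e f X Y)
    small-caseY refl 2≤β X<1600 =
      subst (λ e′ → T (separated (bound X) e′ f X Y)) (^-identityʳ e)
        (subst (λ x → T (separated (bound x) x f x Y)) Y+1+pred-η≡X
          (separatedY f (β ∸ 2) Y (pred η) (cong (f ^_) (sym (2+_∸2 2≤β))) 2≤f (<-trans Y<X X<1600) (pred-η< (η<10 X<1600))))

    small-caseXY : 2 ≤ α → 2 ≤ β → X < 2 ^ 19 → T (separated (bound X) e f X Y)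
    small-caseXY 2≤α 2≤β X< with 3 ≤? α | 3 ≤? β
    ... | yes 3≤α | _       = proj₁ (separatedXY e (α ∸ 3) f (β ∸ 2) X Y
      (cong (e ^_) (sym (3+_∸3 3≤α))) (cong (f ^_) (sym (2+_∸2 2≤β))) 2≤e 2≤f X< (<-trans Y<X X<))
    ... | no  _   | yes 3≤β = proj₂ (separatedXY f (β ∸ 3) e (α ∸ 2) Y X
      (cong (f ^_) (sym (3+_∸3 3≤β))) (cong (e ^_) (sym (2+_∸2 2≤α))) 2≤f 2≤e (<-trans Y<X X<) X<)
    ... | no  α<3 | no  β<3 = ⊥-elim (equal-exponents
      (trans (≤-antisym (s≤s⁻¹ (≰⇒> α<3)) 2≤α) (sym (≤-antisym (s≤s⁻¹ (≰⇒> β<3)) 2≤β))) 2≤α)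

    -- `i` is a lower bound for log₂ X. The last hypothesis says in exponents that the `6H - 92`
    -- spare factors `X` absorb the power of 2 in `S²≤X^H`.
    large-H : ∀ i → 64 ≤ X → 2 ^ i ≤ X → 52 ≤ H → 30 * H + 186 ≤ i * (6 * H ∸ 92) → ⊥
    large-H i 64≤X 2^i≤X 52≤H exps = go (suc H) refl
      where
      open ≤-Reasoning
      k = 6 * H ∸ 92
      -- From `32η ≤ X` Bernoulli gives (X/Y)⁵ ≤ 32/27, and (32/27)⁴ is just below 2.
      X^20≤ : (Y + η) ^ 20 ≤ 2 * Y ^ 20
      X^20≤ = subst (λ x → x ^ 20 ≤ 2 * Y ^ 20) (sym Y+η≡X) (*-cancelˡ-≤ (27 ^ 4) (begin
        27 ^ 4 * X ^ 20          ≡⟨ cong (27 ^ 4 *_) (sym (^-*-assoc X 5 4)) ⟩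
        27 ^ 4 * (X ^ 5) ^ 4     ≡⟨ sym (^-distribʳ-* 4 27 (X ^ 5)) ⟩
        (27 * X ^ 5) ^ 4         ≤⟨ ^-monoˡ-≤ 4 (ratio 32 5 27 5 refl (≤-trans (≤-reflexive (l η)) (*-monoʳ-≤ 5 (scaled-gap 32 64 refl 64≤X)))) ⟩
        (32 * Y ^ 5) ^ 4         ≡⟨ trans (^-distribʳ-* 4 32 (Y ^ 5)) (cong (32 ^ 4 *_) (^-*-assoc Y 5 4)) ⟩
        32 ^ 4 * Y ^ 20          ≤⟨ *-monoˡ-≤ (Y ^ 20) (≤ᵇ⇒≤ (32 ^ 4) (27 ^ 4 * 2) tt) ⟩
        27 ^ 4 * 2 * Y ^ 20      ≡⟨ *-assoc (27 ^ 4) 2 (Y ^ 20) ⟩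
        27 ^ 4 * (2 * Y ^ 20)    ∎))
        where
        l : ∀ η → 32 * (5 * η) ≡ 5 * (32 * η)
        l = solve-∀
      k≤ : ∀ N → N ≡ suc H → k + (14 * N + 78) ≤ H * 20
      k≤ N refl = begin
        k + (14 * suc H + 78)    ≡⟨ l₁ k H ⟩
        k + 92 + 14 * H          ≡⟨ cong (_+ 14 * H) (m∸n+n≡m (≤-trans (≤ᵇ⇒≤ 92 312 tt) (*-monoʳ-≤ 6 52≤H))) ⟩
        6 * H + 14 * H           ≡⟨ l₂ H ⟩
        H * 20                   ∎
        where
        l₁ : ∀ k H → k + (14 * suc H + 78) ≡ k + 92 + 14 * H
        l₁ = solve-∀
        l₂ : ∀ H → 6 * H + 14 * H ≡ H * 20
        l₂ = solve-∀
      30N+156 : ∀ N → N ≡ suc H → 30 * N + 156 ≤ i * k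
      30N+156 N refl = ≤-trans (≤-reflexive (l H)) exps
        where
        l : ∀ H → 30 * suc H + 156 ≡ 30 * H + 186
        l = solve-∀
      2^≤X^k : ∀ m → m ≤ i * k → 2 ^ m ≤ (Y + η) ^ k
      2^≤X^k m m≤ = begin
        2 ^ m            ≤⟨ ^-monoʳ-≤ 2 m≤ ⟩
        2 ^ (i * k)      ≡⟨ sym (^-*-assoc 2 i k) ⟩
        (2 ^ i) ^ k      ≤⟨ ^-monoˡ-≤ k 2^i≤X ⟩
        X ^ k            ≡⟨ cong (_^ k) (sym Y+η≡X) ⟩
        (Y + η) ^ k      ∎
      go : ∀ N → N ≡ suc H → ⊥
      go N N≡ = [ short , long ]′ (≤-total w (N * β))
        where
        contradiction : ∀ φ φ′ .{{_ : NonZero φ′}} → V * φ ≡ Y ^ N * φ′ → Y ^ N * φ′ ≤ (Y + η) ^ N → ⊥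
        contradiction φ φ′ eq le = Large.large-X Y η H N N≡ U V φ φ′ δ approach eq le
          (subst (16 * (η * η) <_) (sym Y+η≡X) gap) X^20≤ (≤-trans (≤ᵇ⇒≤ 4 52 tt) 52≤H)
          k (k≤ N N≡) (2^≤X^k (30 * N + 156) (30N+156 N N≡))
        short : w ≤ N * β → ⊥
        short w≤ = contradiction (f ^ (N * β ∸ w)) 1
          (trans (sym (^-distribˡ-+-* f w (N * β ∸ w)))
            (trans (cong (f ^_) (m+[n∸m]≡n w≤)) (trans (sym (Y^n≡ N)) (sym (*-identityʳ (Y ^ N))))))
          (≤-trans (≤-reflexive (*-identityʳ (Y ^ N))) (^-monoˡ-≤ N (m≤m+n Y η)))
        long : N * β ≤ w → ⊥
        long ≤w = contradiction 1 (f ^ (w ∸ N * β)) {{m^n≢0 f (w ∸ N * β)}} (trans (*-identityʳ V) V≡)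
          (≤-trans (≤-reflexive (sym V≡)) (subst (λ x → V ≤ x ^ N) (sym Y+η≡X) (V≤X^[1+H] N N≡)))
          where
          V≡ : V ≡ Y ^ N * f ^ (w ∸ N * β)
          V≡ = trans (cong (f ^_) (sym (m+[n∸m]≡n ≤w)))
            (trans (^-distribˡ-+-* f (N * β) (w ∸ N * β)) (cong (_* f ^ (w ∸ N * β)) (sym (Y^n≡ N))))

    large-H₁₂₃ : 65 ≤ X → 123 ≤ H → ⊥
    large-H₁₂₃ 65≤X 123≤H = large-H 6 64≤X 64≤X (≤-trans (≤ᵇ⇒≤ 52 123 tt) 123≤H) (begin
      30 * H + 186          ≤⟨ m+n≤o⇒m≤o∸n (30 * H + 186) (begin
        30 * H + 186 + 6 * 92   ≡⟨ +-assoc (30 * H) 186 552 ⟩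
        30 * H + 738            ≤⟨ +-monoʳ-≤ (30 * H) (*-monoʳ-≤ 6 123≤H) ⟩
        30 * H + 6 * H          ≡⟨ l H ⟩
        6 * (6 * H)             ∎) ⟩
      6 * (6 * H) ∸ 6 * 92  ≡⟨ sym (*-distribˡ-∸ 6 (6 * H) 92) ⟩
      6 * (6 * H ∸ 92)      ∎)
      where
      open ≤-Reasoning
      64≤X : 64 ≤ X
      64≤X = ≤-trans (n≤1+n 64) 65≤X
      l : ∀ H → 30 * H + 6 * H ≡ 6 * (6 * H)
      l = solve-∀

    large-H₅₂ : 256 ≤ X → 52 ≤ H → ⊥
    large-H₅₂ 256≤X 52≤H = large-H 8 (≤-trans (≤ᵇ⇒≤ 64 256 tt) 256≤X) 256≤X 52≤H (begin
      30 * H + 186          ≤⟨ m+n≤o⇒m≤o∸n (30 * H + 186) (begin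
        30 * H + 186 + 8 * 92   ≡⟨ +-assoc (30 * H) 186 736 ⟩
        30 * H + 922            ≤⟨ +-monoʳ-≤ (30 * H) (≤-trans (≤ᵇ⇒≤ 922 936 tt) (*-monoʳ-≤ 18 52≤H)) ⟩
        30 * H + 18 * H         ≡⟨ l H ⟩
        8 * (6 * H)             ∎) ⟩
      8 * (6 * H) ∸ 8 * 92  ≡⟨ sym (*-distribˡ-∸ 8 (6 * H) 92) ⟩
      8 * (6 * H ∸ 92)      ∎)
      where
      open ≤-Reasoning
      l : ∀ H → 30 * H + 18 * H ≡ 8 * (6 * H)
      l = solve-∀

    -- The exponent ⌈w/β⌉ is the least `L` for which `V` divides `Y ^ L`. Minimality gives
    -- `Y ^ l < V ≤ X ^ (H + 1)` for `L = suc l`, and this bounds the excess of `L` over `H`.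
    large-H₉₀₀ : X < 65 → 900 ≤ H → ⊥
    large-H₉₀₀ X<65 900≤H = go (ceiling w (pred β))
      where
      open ≤-Reasoning
      η≡1 : η ≡ 1
      η≡1 = ≤-antisym (s≤s⁻¹ (≰⇒> λ 2≤η → <⇒≱ gap (≤-trans (s≤s⁻¹ X<65) (*-monoʳ-≤ 16 (*-mono-≤ 2≤η 2≤η))))) (>-nonZero⁻¹ η)
      Y+1≡X : Y + 1 ≡ X
      Y+1≡X = trans (cong (Y +_) (sym η≡1)) Y+η≡X
      H≤L : ∀ L → V ≤ Y ^ L → H ≤ L
      H≤L L V≤ = ≮⇒≥ λ L<H → <⇒≱ (begin-strict
        16 * X ^ L           <⟨ *-monoˡ-< (X ^ L) {{m^n≢0 X L}} 16<X ⟩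
        X * X ^ L            ≤⟨ ^-monoʳ-≤ X L<H ⟩
        X ^ H                ≤⟨ m≤n*m (X ^ H) 15 ⟩
        15 * X ^ H           ∎) (begin
        15 * X ^ H           ≤⟨ *-monoʳ-≤ 15 X^H≤U ⟩
        15 * U               ≤⟨ Near.U≤V near ⟩
        16 * V               ≤⟨ *-monoʳ-≤ 16 (≤-trans V≤ (^-monoˡ-≤ L (<⇒≤ Y<X))) ⟩
        16 * X ^ L           ∎)
      go : (∃ λ L → w ≤ L * suc (pred β) × L * suc (pred β) ≤ w + pred β) → ⊥
      go (zero  , w≤ , _)  = n≮0 (<-≤-trans β<w w≤)
      go (suc l , w≤ , ≤w) = small-X Y H l (l + 1 ∸ H) U V (f ^ ((l + 1) * β ∸ w)) δ
          (s≤s⁻¹ (subst (17 ≤_) (trans (sym Y+1≡X) (+-comm Y 1)) 16<X))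
          (s≤s⁻¹ (subst (λ x → x < 65) (trans (sym Y+1≡X) (+-comm Y 1)) X<65))
          900≤H
          (subst (λ η → Approach Y η H U V δ) η≡1 approach)
          Vφ
          (sym (m+[n∸m]≡n (H≤L (l + 1) (≤-trans (m≤m*n V (f ^ ((l + 1) * β ∸ w)) {{m^n≢0 f ((l + 1) * β ∸ w)}}) (≤-reflexive Vφ)))))
          (begin-strict
            Y ^ l              ≡⟨ Y^n≡ l ⟩
            f ^ (l * β)        <⟨ ^-monoʳ-< f 2≤f lβ<w ⟩
            V                  ≤⟨ V≤X^[1+H] (H + 1) (+-comm H 1) ⟩
            X ^ (H + 1)        ≡⟨ cong (_^ (H + 1)) (sym Y+1≡X) ⟩
            (Y + 1) ^ (H + 1)  ∎)
        where
        w≤′ : w ≤ (l + 1) * β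
        w≤′ = ≤-trans w≤ (≤-reflexive (cong₂ _*_ (+-comm 1 l) (suc-pred β)))
        Vφ : V * f ^ ((l + 1) * β ∸ w) ≡ Y ^ (l + 1)
        Vφ = trans (sym (^-distribˡ-+-* f w ((l + 1) * β ∸ w))) (trans (cong (f ^_) (m+[n∸m]≡n w≤′)) (sym (Y^n≡ (l + 1))))
        lβ<w : l * β < w
        lβ<w = +-cancelˡ-< (pred β) _ _ (begin-strict
          pred β + l * β             <⟨ n<1+n _ ⟩
          suc (pred β) + l * β       ≡⟨ cong (λ b → suc (pred β) + l * b) (sym (suc-pred β)) ⟩
          suc l * suc (pred β)       ≤⟨ ≤w ⟩
          w + pred β                 ≡⟨ +-comm w (pred β) ⟩
          pred β + w                 ∎)

    u≤52α : H < 52 → u ≤ 52 * α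
    u≤52α H<52 = ≤-trans (<⇒≤ u<[1+H]α) (*-monoˡ-≤ α H<52)

    -- An upper bound r/p for (X/Y)ⁿ becomes the upper bound 9r/(8p) for `f`.
    f<-from : ∀ n p r {c} → u ≤ n → 6 * (α * α) ≤ X → 6 * (β * β) ≤ X → p * X ^ n ≤ r * Y ^ n →
      9 * r < 8 * p * c → f < c
    f<-from n p r {c} u≤n 6α² 6β² le lt = ≰⇒> λ c≤f → <⇒≱ lt (≤-trans (*-monoʳ-≤ (8 * p) c≤f)
      (*-cancelʳ-≤ (8 * p * f) (9 * r) (Y ^ n) {{m^n≢0 Y n}} (begin
        8 * p * f * Y ^ n        ≡⟨ l₁ p f (Y ^ n) ⟩
        p * (8 * (f * Y ^ n))    ≤⟨ *-monoʳ-≤ p (f*Y^n≤ 6α² 6β² n u≤n) ⟩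
        p * (9 * X ^ n)          ≡⟨ l₂ p (X ^ n) ⟩
        9 * (p * X ^ n)          ≤⟨ *-monoʳ-≤ 9 le ⟩
        9 * (r * Y ^ n)          ≡⟨ sym (*-assoc 9 r (Y ^ n)) ⟩
        9 * r * Y ^ n            ∎)))
      where
      open ≤-Reasoning
      l₁ : ∀ p f y → 8 * p * f * y ≡ p * (8 * (f * y))
      l₁ = solve-∀
      l₂ : ∀ p x → p * (9 * x) ≡ 9 * (p * x)
      l₂ = solve-∀

    31X≤32Y : 64 ≤ X → 31 * X ≤ 32 * Y
    31X≤32Y 64≤X = +-cancelʳ-≤ X _ _ (begin
      31 * X + X        ≡⟨ +-comm (31 * X) X ⟩
      32 * X            ≡⟨ cong (32 *_) (sym Y+η≡X) ⟩
      32 * (Y + η)      ≡⟨ *-distribˡ-+ 32 Y η ⟩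
      32 * Y + 32 * η   ≤⟨ +-monoʳ-≤ (32 * Y) (scaled-gap 32 64 refl 64≤X) ⟩
      32 * Y + X        ∎)
      where open ≤-Reasoning

    small-H₁₁ : α ≡ 1 → β ≡ 1 → 256 ≤ X → H < 52 → ⊥
    small-H₁₁ refl refl 256≤X H<52 = <⇒≱ f<5 (≤-trans (≤ᵇ⇒≤ 5 6 tt) 6≤f)
      where
      open ≤-Reasoning
      6≤X : 6 ≤ X
      6≤X = ≤-trans (≤ᵇ⇒≤ 6 256 tt) 256≤X
      -- Bernoulli needs `52η ≤ X`, which follows from the gap once `X` is at least 52²/16 = 169.
      -- The resulting bound on `f` is absurd, as `f` is `Y` itself.
      X^26≤ : X ^ 26 ≤ 2 * Y ^ 26
      X^26≤ = ≤-trans (≤-reflexive (sym (*-identityˡ (X ^ 26)))) (ratio 2 1 1 26 refl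
        (≤-trans (≤-reflexive (sym (*-assoc 2 26 η))) (≤-trans (scaled-gap 52 169 refl (≤-trans (≤ᵇ⇒≤ 169 256 tt) 256≤X)) (≤-reflexive (sym (*-identityˡ X))))))
      X^52≤ : 1 * X ^ 52 ≤ 4 * Y ^ 52
      X^52≤ = begin
        1 * X ^ 52            ≡⟨ *-identityˡ (X ^ 52) ⟩
        X ^ 52                ≡⟨ sym (^-*-assoc X 26 2) ⟩
        (X ^ 26) ^ 2          ≤⟨ ^-monoˡ-≤ 2 X^26≤ ⟩
        (2 * Y ^ 26) ^ 2      ≡⟨ ^-distribʳ-* 2 2 (Y ^ 26) ⟩
        4 * (Y ^ 26) ^ 2      ≡⟨ cong (4 *_) (^-*-assoc Y 26 2) ⟩
        4 * Y ^ 52            ∎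
      f<5 : f < 5
      f<5 = f<-from 52 1 4 (u≤52α H<52) 6≤X 6≤X X^52≤ (≤ᵇ⇒≤ 37 40 tt)
      6≤f : 6 ≤ f
      6≤f = ≰⇒> λ f≤5 → <⇒≱ (≤ᵇ⇒≤ 161 (31 * 256) tt) (begin
        31 * 256       ≤⟨ *-monoʳ-≤ 31 256≤X ⟩
        31 * X         ≤⟨ 31X≤32Y (≤-trans (≤ᵇ⇒≤ 64 256 tt) 256≤X) ⟩
        32 * Y         ≤⟨ *-monoʳ-≤ 32 (≤-trans (≤-reflexive (^-identityʳ f)) f≤5) ⟩
        32 * 5         ∎)

    6α²≤X : 1600 ≤ X → 6 * (α * α) ≤ X
    6α²≤X = quadratic≤ 6 14 1600 {α} (≤ᵇ⇒≤ 3 14 tt) (≤ᵇ⇒≤ (6 * (14 * 14)) (2 ^ 14) tt) (≤ᵇ⇒≤ (6 * (14 * 14)) 1600 tt) 2^α≤X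

    6β²≤X : 1600 ≤ X → 6 * (β * β) ≤ X
    6β²≤X = quadratic≤ 6 14 1600 {β} (≤ᵇ⇒≤ 3 14 tt) (≤ᵇ⇒≤ (6 * (14 * 14)) (2 ^ 14) tt) (≤ᵇ⇒≤ (6 * (14 * 14)) 1600 tt) 2^β≤X

    -- This takes `156η ≤ X`, available from `X = 156²/16 = 1521` on.
    2X^52≤3Y^52 : 1600 ≤ X → 2 * X ^ 52 ≤ 3 * Y ^ 52
    2X^52≤3Y^52 1600≤X = ratio 3 1 2 52 refl (≤-trans (≤-reflexive (sym (*-assoc 3 52 η)))
      (≤-trans (scaled-gap 156 1521 refl (≤-trans (≤ᵇ⇒≤ 1521 1600 tt) 1600≤X)) (≤-reflexive (sym (*-identityˡ X)))))

    small-H₁ : α ≡ 1 → 1600 ≤ X → H < 52 → ⊥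
    small-H₁ refl 1600≤X H<52 = <⇒≱ (f<-from 52 2 3 (u≤52α H<52) (6α²≤X 1600≤X) (6β²≤X 1600≤X)
      (2X^52≤3Y^52 1600≤X) (≤ᵇ⇒≤ 28 32 tt)) 2≤f

    -- Here `f` is `Y`. Its upper bound 9/8 · (3/2)^α grows with `α`, but (3/2)^α ≤ 9/16 · 2^α and
    -- `2 ^ α ≤ X` keep it below 81/128 · X, which is less than `Y`.
    small-HX : 2 ≤ α → β ≡ 1 → 1600 ≤ X → H < 52 → ⊥
    small-HX 2≤α refl 1600≤X H<52 = <⇒≱ (f<-from (52 * α) (2 ^ α) (3 ^ α) {Y} (u≤52α H<52) (6α²≤X 1600≤X) (6β²≤X 1600≤X) powers≤ 9*3^α<)
        (≤-reflexive (^-identityʳ f))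
      where
      open ≤-Reasoning
      powers≤ : 2 ^ α * X ^ (52 * α) ≤ 3 ^ α * Y ^ (52 * α)
      powers≤ = begin
        2 ^ α * X ^ (52 * α)       ≡⟨ cong (2 ^ α *_) (sym (^-*-assoc X 52 α)) ⟩
        2 ^ α * (X ^ 52) ^ α       ≡⟨ sym (^-distribʳ-* α 2 (X ^ 52)) ⟩
        (2 * X ^ 52) ^ α           ≤⟨ ^-monoˡ-≤ α (2X^52≤3Y^52 1600≤X) ⟩
        (3 * Y ^ 52) ^ α           ≡⟨ ^-distribʳ-* α 3 (Y ^ 52) ⟩
        3 ^ α * (Y ^ 52) ^ α       ≡⟨ cong (3 ^ α *_) (^-*-assoc Y 52 α) ⟩
        3 ^ α * Y ^ (52 * α)       ∎
      16*3^≤ : ∀ n → 2 ≤ n → 16 * 3 ^ n ≤ 9 * 4 ^ n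
      16*3^≤ (suc (suc n)) _ = begin
        16 * (3 * (3 * 3 ^ n))     ≡⟨ l₁ (3 ^ n) ⟩
        144 * 3 ^ n                ≤⟨ *-monoʳ-≤ 144 (^-monoˡ-≤ n (n≤1+n 3)) ⟩
        144 * 4 ^ n                ≡⟨ l₂ (4 ^ n) ⟩
        9 * (4 * (4 * 4 ^ n))      ∎
        where
        l₁ : ∀ x → 16 * (3 * (3 * x)) ≡ 144 * x
        l₁ = solve-∀
        l₂ : ∀ x → 144 * x ≡ 9 * (4 * (4 * x))
        l₂ = solve-∀
      16*3^≤ (suc zero) (s≤s ())
      81X<128Y : 81 * X < 128 * Y
      81X<128Y = *-cancelˡ-< 31 _ _ (begin-strict
        31 * (81 * X)      ≡⟨ l₁ X ⟩
        81 * (31 * X)      ≤⟨ *-monoʳ-≤ 81 (31X≤32Y (≤-trans (≤ᵇ⇒≤ 64 1600 tt) 1600≤X)) ⟩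
        81 * (32 * Y)      ≡⟨ sym (*-assoc 81 32 Y) ⟩
        2592 * Y           <⟨ *-monoˡ-< Y (≤ᵇ⇒≤ 2593 3968 tt) ⟩
        3968 * Y           ≡⟨ *-assoc 31 128 Y ⟩
        31 * (128 * Y)     ∎)
        where
        l₁ : ∀ X → 31 * (81 * X) ≡ 81 * (31 * X)
        l₁ = solve-∀
      9*3^α< : 9 * 3 ^ α < 8 * 2 ^ α * Y
      9*3^α< = *-cancelˡ-< 16 _ _ (begin-strict
        16 * (9 * 3 ^ α)           ≡⟨ l₁ (3 ^ α) ⟩
        9 * (16 * 3 ^ α)           ≤⟨ *-monoʳ-≤ 9 (16*3^≤ α 2≤α) ⟩
        9 * (9 * 4 ^ α)            ≡⟨ cong (λ x → 9 * (9 * x)) (^-distribʳ-* α 2 2) ⟩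
        9 * (9 * (2 ^ α * 2 ^ α))  ≤⟨ *-monoʳ-≤ 9 (*-monoʳ-≤ 9 (*-monoʳ-≤ (2 ^ α) 2^α≤X)) ⟩
        9 * (9 * (2 ^ α * X))      ≡⟨ l₂ (2 ^ α) X ⟩
        2 ^ α * (81 * X)           <⟨ *-monoʳ-< (2 ^ α) {{m^n≢0 2 α}} 81X<128Y ⟩
        2 ^ α * (128 * Y)          ≡⟨ l₃ (2 ^ α) Y ⟩
        16 * (8 * 2 ^ α * Y)       ∎)
        where
        l₁ : ∀ x → 16 * (9 * x) ≡ 9 * (16 * x)
        l₁ = solve-∀
        l₂ : ∀ a x → 9 * (9 * (a * x)) ≡ a * (81 * x)
        l₂ = solve-∀
        l₃ : ∀ a y → a * (128 * y) ≡ 16 * (8 * a * y)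
        l₃ = solve-∀

    -- `128αη ≤ X` makes the loss in Bernoulli's inequality at most 13/32, and 9/8 · 32/19 is less
    -- than 2. The threshold arises because `1024 * (n * n) ≤ 2 ^ n` holds from `n = 19` on and
    -- fails at 18.
    small-HXY : 2 ^ 19 ≤ X → H < 52 → ⊥
    small-HXY 2^19≤X H<52 = <⇒≱ (f<-from (52 * α) 19 32 (u≤52α H<52) (6α²≤X 1600≤X) (6β²≤X 1600≤X)
        (ratio 32 13 19 (52 * α) refl small) (≤ᵇ⇒≤ 289 304 tt)) 2≤f
      where
      1600≤X : 1600 ≤ X
      1600≤X = ≤-trans (≤ᵇ⇒≤ 1600 (2 ^ 19) tt) 2^19≤X
      1024α²≤X : 1024 * (α * α) ≤ X
      1024α²≤X = quadratic≤ 1024 19 (2 ^ 19) {α} (≤ᵇ⇒≤ 3 19 tt) (≤ᵇ⇒≤ (1024 * (19 * 19)) (2 ^ 19) tt) (≤ᵇ⇒≤ (1024 * (19 * 19)) (2 ^ 19) tt) 2^α≤X 2^19≤X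
      small : 32 * (52 * α * η) ≤ 13 * X
      small = ≤-trans (≤-reflexive (l₁ α η)) (*-monoʳ-≤ 13 (scaled-gap (128 * α) (1024 * (α * α)) (l₂ α) 1024α²≤X))
        where
        l₁ : ∀ α η → 32 * (52 * α * η) ≡ 13 * (128 * α * η)
        l₁ = solve-∀
        l₂ : ∀ α → 128 * α * (128 * α) ≡ 16 * (1024 * (α * α))
        l₂ = solve-∀

    data Exponents : Set where
      both-1   : α ≡ 1 → β ≡ 1 → Exponents
      only-β-1 : 2 ≤ α → β ≡ 1 → Exponents
      only-α-1 : α ≡ 1 → 2 ≤ β → Exponents
      neither  : 2 ≤ α → 2 ≤ β → Exponents

    exponents : Exponents
    exponents with m≤n⇒m<n∨m≡n 1≤α | m≤n⇒m<n∨m≡n 1≤β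
    ... | inj₁ 2≤α | inj₁ 2≤β = neither 2≤α 2≤β
    ... | inj₁ 2≤α | inj₂ 1≡β = only-β-1 2≤α (sym 1≡β)
    ... | inj₂ 1≡α | inj₁ 2≤β = only-α-1 (sym 1≡α) 2≤β
    ... | inj₂ 1≡α | inj₂ 1≡β = both-1 (sym 1≡α) (sym 1≡β)

    small-case : X < 256 → T (separated (bound X) e f X Y)
    small-case X<256 with exponents
    ... | both-1 α≡1 β≡1   = small-case₁₁ α≡1 β≡1 X<256
    ... | only-β-1 2≤α β≡1 = small-caseX 2≤α β≡1 (≤-trans X<256 (≤ᵇ⇒≤ 256 1600 tt))
    ... | only-α-1 α≡1 2≤β = small-caseY α≡1 2≤β (≤-trans X<256 (≤ᵇ⇒≤ 256 1600 tt))
    ... | neither 2≤α 2≤β  = small-caseXY 2≤α 2≤β (≤-trans X<256 (≤ᵇ⇒≤ 256 (2 ^ 19) tt))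

    finite-below : ∀ n → bound X ≡ n → H < n → T (separated (bound X) e f X Y) → ⊥
    finite-below n eq H<n t = finite t (subst (λ n → U < X ^ n) (sym eq) (U<X^n n H<n))

    small-H : 256 ≤ X → H < 52 → ⊥
    small-H 256≤X H<52 with exponents
    ... | both-1 α≡1 β≡1   = small-H₁₁ α≡1 β≡1 256≤X H<52
    ... | only-β-1 2≤α β≡1 = [ (λ X< → finite-below 52 (bound-52 256≤X) H<52 (small-caseX 2≤α β≡1 X<))
                             , (λ ≤X → small-HX 2≤α β≡1 ≤X H<52) ]′ (<-≤-connex X 1600)
    ... | only-α-1 α≡1 2≤β = [ (λ X< → finite-below 52 (bound-52 256≤X) H<52 (small-caseY α≡1 2≤β X<))
                             , (λ ≤X → small-H₁ α≡1 ≤X H<52) ]′ (<-≤-connex X 1600)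
    ... | neither 2≤α 2≤β  = [ (λ X< → finite-below 52 (bound-52 256≤X) H<52 (small-caseXY 2≤α 2≤β X<))
                             , (λ ≤X → small-HXY ≤X H<52) ]′ (<-≤-connex X (2 ^ 19))

    impossible : ⊥
    impossible with <-≤-connex X 65 | <-≤-connex X 256
    ... | inj₁ X<65 | _ =
      [ (λ H< → finite-below 900 (bound-900 X<65) H< (small-case (≤-trans X<65 (≤ᵇ⇒≤ 65 256 tt))))
      , large-H₉₀₀ X<65 ]′ (<-≤-connex H 900)
    ... | inj₂ 65≤X | inj₁ X<256 =
      [ (λ H< → finite-below 123 (bound-123 65≤X X<256) H< (small-case X<256))
      , large-H₁₂₃ 65≤X ]′ (<-≤-connex H 123)
    ... | inj₂ _ | inj₂ 256≤X = [ small-H 256≤X , large-H₅₂ 256≤X ]′ (<-≤-connex H 52)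

module MultiplicativeDependence where

  open import Data.Empty using (⊥; ⊥-elim)
  open import Data.Integer as ℤ using (+_; -[1+_]; +[1+_])
  import Data.Integer.Properties as ℤ
  open import Data.Nat
  open import Data.Nat.Coprimality using (Coprime; coprime-divisor; coprime-/gcd; 1-coprimeTo) renaming (sym to coprime-sym)
  open import Data.Nat.Divisibility
  open import Data.Nat.DivMod using (_/_; m/n*n≡m)
  open import Data.Nat.GCD using (gcd; gcd[m,n]∣m; gcd[m,n]∣n; gcd[m,n]≢0)
  open import Data.Nat.Properties
  open import Data.Nat.Tactic.RingSolver using (solve-∀)
  open import Data.Product using (∃; ∃₂; _,_; _×_; proj₁; proj₂; swap)
  open import Data.Rational as ℚ using (mkℚ; 1ℚ)
  import Data.Rational.Properties as ℚ
  open import Data.Sum using (inj₁)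
  open import Data.Unit using (tt)
  open import Relation.Binary.Definitions using (Tri; tri<; tri≈; tri>)
  open import Relation.Binary.PropositionalEquality
  open import Relation.Nullary using (¬_)
  open ClosePowers

  -- Common bases of integers with equal powers

  coprime-^ : ∀ {m n} k → Coprime m n → Coprime m (n ^ k)
  coprime-^ zero    c = coprime-sym (1-coprimeTo _)
  coprime-^ {m} {n} (suc k) c {d} (d∣m , d∣n*n^k) = coprime-^ k c (d∣m , coprime-divisor d-n d∣n*n^k)
    where
    d-n : Coprime d n
    d-n (i∣d , i∣n) = c (∣-trans i∣d d∣m , i∣n)

  -- After division by the gcd, `x′` is coprime to every power of `y′` and divides one of them, so
  -- it is 1.
  ^-∣-cancel : ∀ k {x y} .{{_ : NonZero x}} → x ^ suc k ∣ y ^ suc k → x ∣ y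
  ^-∣-cancel k {x} {y} x^∣y^ = subst (_∣ y) (sym x≡g) (gcd[m,n]∣n x y)
    where
    g = gcd x y
    instance
      g≢0 : NonZero g
      g≢0 = ≢-nonZero (gcd[m,n]≢0 x y (inj₁ (≢-nonZero⁻¹ x)))
    x′ = x / g
    y′ = y / g
    x≡ : x′ * g ≡ x
    x≡ = m/n*n≡m (gcd[m,n]∣m x y)
    y≡ : y′ * g ≡ y
    y≡ = m/n*n≡m (gcd[m,n]∣n x y)
    x′^∣y′^ : x′ ^ suc k ∣ y′ ^ suc k
    x′^∣y′^ = *-cancelʳ-∣ (g ^ suc k) {{m^n≢0 g (suc k)}}
      (subst₂ _∣_ (trans (cong (_^ suc k) (sym x≡)) (^-distribʳ-* (suc k) x′ g))
                  (trans (cong (_^ suc k) (sym y≡)) (^-distribʳ-* (suc k) y′ g)) x^∣y^)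
    x′∣y′^ : x′ ∣ y′ ^ suc k
    x′∣y′^ = ∣-trans (∣m⇒∣m*n (x′ ^ k) ∣-refl) x′^∣y′^
    x′≡1 : x′ ≡ 1
    x′≡1 = coprime-^ (suc k) (coprime-/gcd x y) (∣-refl , x′∣y′^)
    x≡g : x ≡ g
    x≡g = trans (sym x≡) (trans (cong (_* g) x′≡1) (*-identityˡ g))

  record CommonBase (a b : ℕ) : Set where
    constructor common-base
    field
      {base i j} : ℕ
      2≤base  : 2 ≤ base
      1≤i     : 1 ≤ i
      1≤j     : 1 ≤ j
      coprime : Coprime i j
      a≡      : a ≡ base ^ i
      b≡      : b ≡ base ^ j

  commonBase-sym : ∀ {a b} → CommonBase a b → CommonBase b a
  commonBase-sym (common-base g≥2 i≥1 j≥1 c a≡ b≡) = common-base g≥2 j≥1 i≥1 (coprime-sym c) b≡ a≡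

  -- Euclid's algorithm by subtraction, on the exponents of the unknown base: `a < b` forces
  -- `a ∣ b`, and the quotient satisfies a relation of the same kind with `a`. The bound `N` on the
  -- sum makes the recursion structural. Exponents `i`, `j` become `i`, `j + i`, which preserves
  -- coprimality.
  ^-≡-^⇒commonBase : ∀ N {a b} → a + b ≤ N → 2 ≤ a → 2 ≤ b → ∀ n m → a ^ suc n ≡ b ^ suc m → CommonBase a b
  ^-≡-^⇒commonBase-< : ∀ N {a b} → a + b ≤ N → 2 ≤ a → a < b → ∀ n m → a ^ suc n ≡ b ^ suc m → CommonBase a b

  ^-≡-^⇒commonBase N {a} {b} a+b≤N 2≤a 2≤b n m eq with <-cmp a b
  ... | tri< a<b _ _  = ^-≡-^⇒commonBase-< N a+b≤N 2≤a a<b n m eq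
  ... | tri≈ _ refl _ = common-base 2≤a ≤-refl ≤-refl (1-coprimeTo 1) (sym (^-identityʳ a)) (sym (^-identityʳ a))
  ... | tri> _ _ b<a  = commonBase-sym
    (^-≡-^⇒commonBase-< N (≤-trans (≤-reflexive (+-comm b a)) a+b≤N) 2≤b b<a m n (sym eq))

  ^-≡-^⇒commonBase-< zero {a} a+b≤0 2≤a _ _ _ _ = ⊥-elim (n≮0 (≤-trans (≤-trans 2≤a (m≤m+n a _)) a+b≤0))
  ^-≡-^⇒commonBase-< (suc N) {a} {b} a+b≤N 2≤a a<b n m eq = go a∣b
    where
    instance
      a≢0 : NonZero a
      a≢0 = >-nonZero (≤-trans (s≤s z≤n) 2≤a)
    m<n : m < n
    m<n = ≰⇒> λ n≤m → <⇒≢ (≤-<-trans (^-monoʳ-≤ a (s≤s n≤m)) (^-monoˡ-< (suc m) a<b)) eq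
    n≡ : n ≡ m + suc (n ∸ suc m)
    n≡ = trans (sym (m+[n∸m]≡n m<n)) (sym (+-suc m (n ∸ suc m)))
    a^n≡ : a ^ suc n ≡ a ^ suc m * a ^ suc (n ∸ suc m)
    a^n≡ = trans (cong (λ x → a ^ suc x) n≡) (^-distribˡ-+-* a (suc m) (suc (n ∸ suc m)))
    a∣b : a ∣ b
    a∣b = ^-∣-cancel m (subst (a ^ suc m ∣_) (trans (sym a^n≡) eq) (∣m⇒∣m*n (a ^ suc (n ∸ suc m)) ∣-refl))
    go : a ∣ b → CommonBase a b
    go (divides c b≡c*a) = extend (^-≡-^⇒commonBase N (s≤s⁻¹ (<-≤-trans smaller a+b≤N)) 2≤a 2≤c (n ∸ suc m) m eq′)
      where
      2≤c : 2 ≤ c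
      2≤c = ≰⇒> λ c≤1 → <⇒≱ a<b (≤-trans (≤-reflexive b≡c*a) (≤-trans (*-monoˡ-≤ a c≤1) (≤-reflexive (*-identityˡ a))))
      smaller : a + c < a + b
      smaller = +-monoʳ-< a (≤-trans (m<m*n c a {{>-nonZero (≤-trans (s≤s z≤n) 2≤c)}} 2≤a) (≤-reflexive (sym b≡c*a)))
      eq′ : a ^ suc (n ∸ suc m) ≡ c ^ suc m
      eq′ = *-cancelˡ-≡ _ _ (a ^ suc m) {{m^n≢0 a (suc m)}} (begin
        a ^ suc m * a ^ suc (n ∸ suc m)  ≡⟨ sym a^n≡ ⟩
        a ^ suc n                        ≡⟨ eq ⟩
        b ^ suc m                        ≡⟨ cong (_^ suc m) (trans b≡c*a (*-comm c a)) ⟩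
        (a * c) ^ suc m                  ≡⟨ ^-distribʳ-* (suc m) a c ⟩
        a ^ suc m * c ^ suc m            ∎)
        where open ≡-Reasoning
      extend : CommonBase a c → CommonBase a b
      extend (common-base {g} {i} {j} 2≤g 1≤i 1≤j cop a≡ c≡) = common-base 2≤g 1≤i (≤-trans 1≤j (m≤m+n j i))
        (λ {d} (d∣i , d∣j+i) → cop (d∣i , ∣m+n∣m⇒∣n (subst (d ∣_) (+-comm j i) d∣j+i) d∣i)) a≡
        (trans b≡c*a (trans (cong₂ _*_ c≡ a≡) (sym (^-distribˡ-+-* g j i))))

  -- From rational powers to powers of natural numbers

  ι-nat : ∀ n → ι (+ n) ≡ mkℚ (+ n) 0 (coprime-sym (1-coprimeTo n))
  ι-nat n = ℚ.normalize-coprime (coprime-sym (1-coprimeTo n))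

  ι-* : ∀ m n → ι (+ m) ℚ.* ι (+ n) ≡ ι (+ (m * n))
  ι-* m n = trans (cong₂ ℚ._*_ (ι-nat m) (ι-nat n)) (cong ι (sym (ℤ.pos-* m n)))

  ι-injective : ∀ {m n} → ι (+ m) ≡ ι (+ n) → m ≡ n
  ι-injective {m} {n} eq = ℤ.+-injective (proj₁ (ℚ.mkℚ-injective (trans (sym (ι-nat m)) (trans eq (ι-nat n)))))

  ι-^ : ∀ a n → ι (+ a) ^ℕ n ≡ ι (+ (a ^ n))
  ι-^ a zero    = refl
  ι-^ a (suc n) = trans (cong (ι (+ a) ℚ.*_) (ι-^ a n)) (ι-* a (a ^ n))

  inv-inverse : ∀ n .{{_ : NonZero n}} → ι (+ n) ℚ.* inv (ι (+ n)) ≡ 1ℚ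
  inv-inverse (suc n) rewrite ι-nat (suc n) = ℚ.*-inverseʳ (mkℚ +[1+ n ] 0 (coprime-sym (1-coprimeTo (suc n))))

  inv-* : ∀ n .{{_ : NonZero n}} q → inv (ι (+ n)) ℚ.* q ≡ 1ℚ → q ≡ ι (+ n)
  inv-* n q eq = begin
    q                                        ≡⟨ sym (ℚ.*-identityˡ q) ⟩
    1ℚ ℚ.* q                                 ≡⟨ cong (ℚ._* q) (sym (inv-inverse n)) ⟩
    ι (+ n) ℚ.* inv (ι (+ n)) ℚ.* q          ≡⟨ ℚ.*-assoc (ι (+ n)) (inv (ι (+ n))) q ⟩
    ι (+ n) ℚ.* (inv (ι (+ n)) ℚ.* q)        ≡⟨ cong (ι (+ n) ℚ.*_) eq ⟩
    ι (+ n) ℚ.* 1ℚ                           ≡⟨ ℚ.*-identityʳ (ι (+ n)) ⟩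
    ι (+ n)                                  ∎
    where open ≡-Reasoning

  PowerRelation : ℕ → ℕ → Set
  PowerRelation a b = ∃₂ λ n m → a ^ suc n ≡ b ^ suc m

  2≤^suc : ∀ {a} n → 2 ≤ a → 2 ≤ a ^ suc n
  2≤^suc {a} n 2≤a = ≤-trans 2≤a (m≤m*n a (a ^ n) {{m^n≢0 a n {{>-nonZero (≤-trans (s≤s z≤n) 2≤a)}}}})

  -- Exponents that are both nonnegative or both negative would make a product of natural numbers
  -- greater than 1 equal to 1. So the signs are opposite, and multiplying by the inverted power
  -- leaves an equality of two positive powers.
  multDep⇒powerRelation : ∀ a b → 2 ≤ a → 2 ≤ b → MultDep₂ (+ a) (+ b) → PowerRelation a b
  multDep⇒powerRelation a b 2≤a 2≤b (k₁ , k₂ , k≢0 , eq) = go k₁ k₂ k≢0 eq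
    where
    instance
      a≢0 : NonZero a
      a≢0 = >-nonZero (≤-trans (s≤s z≤n) 2≤a)
    instance
      b≢0 : NonZero b
      b≢0 = >-nonZero (≤-trans (s≤s z≤n) 2≤b)
    ≢1 : ∀ {x} n → 2 ≤ x → x ^ suc n ≢ 1
    ≢1 n 2≤x eq = <⇒≢ (2≤^suc n 2≤x) (sym eq)
    inv≡ : ∀ x n → inv (ι (+ x) ^ℕ n) ≡ inv (ι (+ (x ^ n)))
    inv≡ x n = cong inv (ι-^ x n)
    product≡1 : ∀ n m → ι (+ (a ^ n)) ℚ.* ι (+ (b ^ m)) ≡ 1ℚ → a ^ n * b ^ m ≡ 1
    product≡1 n m eq = ι-injective (trans (sym (ι-* (a ^ n) (b ^ m))) eq)
    go : ∀ k₁ k₂ → ¬ (k₁ ≡ + 0 × k₂ ≡ + 0) → (ι (+ a) ^ᶻ k₁) ℚ.* (ι (+ b) ^ᶻ k₂) ≡ 1ℚ → PowerRelation a b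
    go (+ zero) (+ zero) k≢0 eq = ⊥-elim (k≢0 (refl , refl))
    go (+ suc n) (+ m) k≢0 eq = ⊥-elim (≢1 n 2≤a (m*n≡1⇒m≡1 (a ^ suc n) (b ^ m)
      (product≡1 (suc n) m (trans (sym (cong₂ ℚ._*_ (ι-^ a (suc n)) (ι-^ b m))) eq))))
    go (+ n) (+ suc m) k≢0 eq = ⊥-elim (≢1 m 2≤b (m*n≡1⇒n≡1 (a ^ n) (b ^ suc m)
      (product≡1 n (suc m) (trans (sym (cong₂ ℚ._*_ (ι-^ a n) (ι-^ b (suc m)))) eq))))
    go (+ n) -[1+ m ] k≢0 eq = nonzero n (ι-injective (inv-* (b ^ suc m) {{m^n≢0 b (suc m)}} (ι (+ (a ^ n)))
        (trans (ℚ.*-comm (inv (ι (+ (b ^ suc m)))) (ι (+ (a ^ n))))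
          (trans (sym (cong₂ ℚ._*_ (ι-^ a n) (inv≡ b (suc m)))) eq))))
      where
      nonzero : ∀ n → a ^ n ≡ b ^ suc m → PowerRelation a b
      nonzero zero    eq = ⊥-elim (≢1 m 2≤b (sym eq))
      nonzero (suc n) eq = n , m , eq
    go -[1+ n ] (+ m) k≢0 eq = nonzero m (ι-injective (inv-* (a ^ suc n) {{m^n≢0 a (suc n)}} (ι (+ (b ^ m)))
        (trans (sym (cong₂ ℚ._*_ (inv≡ a (suc n)) (ι-^ b m))) eq)))
      where
      nonzero : ∀ m → b ^ m ≡ a ^ suc n → PowerRelation a b
      nonzero zero    eq = ⊥-elim (≢1 n 2≤a (sym eq))
      nonzero (suc m) eq = n , m , sym eq
    go -[1+ n ] -[1+ m ] k≢0 eq = ⊥-elim (≢1 m 2≤b (m*n≡1⇒m≡1 (b ^ suc m) (a ^ suc n) (ι-injective (begin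
      ι (+ (b ^ suc m * a ^ suc n))                    ≡⟨ sym (ι-* (b ^ suc m) (a ^ suc n)) ⟩
      ι (+ (b ^ suc m)) ℚ.* ι (+ (a ^ suc n))          ≡⟨ cong (ι (+ (b ^ suc m)) ℚ.*_) (sym invb≡a) ⟩
      ι (+ (b ^ suc m)) ℚ.* inv (ι (+ (b ^ suc m)))    ≡⟨ inv-inverse (b ^ suc m) {{m^n≢0 b (suc m)}} ⟩
      1ℚ                                               ∎))))
      where
      open ≡-Reasoning
      invb≡a : inv (ι (+ (b ^ suc m))) ≡ ι (+ (a ^ suc n))
      invb≡a = inv-* (a ^ suc n) {{m^n≢0 a (suc n)}} _ (trans (sym (cong₂ ℚ._*_ (inv≡ a (suc n)) (inv≡ b (suc m)))) eq)

  multDep⇒commonBase : ∀ a b → 2 ≤ a → 2 ≤ b → MultDep₂ (+ a) (+ b) → CommonBase a b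
  multDep⇒commonBase a b 2≤a 2≤b dep with multDep⇒powerRelation a b 2≤a 2≤b dep
  ... | n , m , eq = ^-≡-^⇒commonBase (a + b) ≤-refl 2≤a 2≤b n m eq

  -- Perturbed pairs and the reduction to close powers

  close-up : ∀ b d → 16 * (d * d) < b → Close b (b + d)
  close-up b d lt =
    subst (λ x → 16 * (x * x) < b + d) (sym (m+n∸m≡n b d)) (<-≤-trans lt (m≤m+n b d)) ,
    subst (λ x → 16 * (x * x) < b) (sym (m≤n⇒m∸n≡0 (m≤m+n b d))) (≤-<-trans z≤n lt)

  close-down : ∀ B d → 16 * (d * d) < B + d → Close (B + d) B
  close-down B d lt =
    subst (λ x → 16 * (x * x) < B) (sym (m≤n⇒m∸n≡0 (m≤m+n B d))) (n≢0⇒n>0 B≢0) ,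
    subst (λ x → 16 * (x * x) < B + d) (sym (m+n∸m≡n B d)) lt
    where
    B≢0 : B ≢ 0
    B≢0 refl = <⇒≱ lt (≤-trans (n≤n*n d) (m≤n*m (d * d) 16))

  perturb : ∀ a ε → + 16 ℤ.* (ε ℤ.* ε) ℤ.< + a → ∃ λ A → + a ℤ.+ ε ≡ + A × Close a A
  perturb a (+ d) lt = a + d , refl ,
    close-up a d (ℤ.drop‿+<+ (subst (ℤ._< + a) (sym (trans (ℤ.pos-* 16 (d * d)) (cong (+ 16 ℤ.*_) (ℤ.pos-* d d)))) lt))
  perturb a -[1+ d ] lt = a ∸ suc d , ℤ.⊖-≥ d<a ,
    subst (λ x → Close x (a ∸ suc d)) (m∸n+n≡m d<a) (close-down (a ∸ suc d) (suc d) (subst (16 * (suc d * suc d) <_) (sym (m∸n+n≡m d<a)) lt′))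
    where
    lt′ : 16 * (suc d * suc d) < a
    lt′ = ℤ.drop‿+<+ lt
    d<a : suc d ≤ a
    d<a = ≤-trans (n≤n*n (suc d)) (≤-trans (m≤n*m (suc d * suc d) 16) (<⇒≤ lt′))

  close-powers-independent : ∀ {a b A B} → 2 ≤ a → a < b → CommonBase a b → Close a A → A ≢ a → Close b B →
    ¬ (2 ≤ A → 2 ≤ B → CommonBase A B)
  close-powers-independent {a} {b} {A} {B} 2≤a a<b
    (common-base {g} {m} {n} 2≤g 1≤m 1≤n cop refl refl) closeA A≢a closeB base = go (<-cmp A a) (base 2≤A (≤-trans 2≤A (<⇒≤ A<B)))
    where
    open ≤-Reasoning
    exponents< : ∀ x {i j} → 2 ≤ x → x ^ i < x ^ j → i < j
    exponents< x 2≤x lt = ≰⇒> λ j≤i → <⇒≱ lt (^-monoʳ-≤ x {{>-nonZero (≤-trans (s≤s z≤n) 2≤x)}} j≤i)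
    m<n : m < n
    m<n = exponents< g 2≤g a<b
    2a≤b : 2 * a ≤ b
    2a≤b = ≤-trans (*-monoˡ-≤ a 2≤g) (^-monoʳ-≤ g {{>-nonZero (≤-trans (s≤s z≤n) 2≤g)}} m<n)
    nearA = proj₂ (close⇒near closeA)
    nearB = proj₂ (close⇒near closeB)
    2≤A : 2 ≤ A
    2≤A = ≰⇒> λ A≤1 → <⇒≱ (≤ᵇ⇒≤ 17 30 tt) (begin
      15 * 2    ≤⟨ *-monoʳ-≤ 15 2≤a ⟩
      15 * a    ≤⟨ Near.U≤V nearA ⟩
      16 * A    ≤⟨ *-monoʳ-≤ 16 A≤1 ⟩
      16        ∎)
    -- Each perturbation changes a number by a factor of at most 16/15, while `b` is at least
    -- `2 * a`, and (16/15)² < 2.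
    A<B : A < B
    A<B = *-cancelˡ-< 225 A B (begin-strict
      225 * A            ≡⟨ *-assoc 15 15 A ⟩
      15 * (15 * A)      ≤⟨ *-monoʳ-≤ 15 (Near.V≤U nearA) ⟩
      15 * (16 * a)      ≡⟨ l₁ a ⟩
      8 * (15 * (2 * a)) ≤⟨ *-monoʳ-≤ 8 (*-monoʳ-≤ 15 2a≤b) ⟩
      8 * (15 * b)       ≤⟨ *-monoʳ-≤ 8 (Near.U≤V nearB) ⟩
      8 * (16 * B)       ≡⟨ sym (*-assoc 8 16 B) ⟩
      128 * B            <⟨ *-monoˡ-< B {{>-nonZero (≤-<-trans z≤n (Near.δ²<V nearB))}} (≤ᵇ⇒≤ 129 225 tt) ⟩
      225 * B            ∎)
      where
      l₁ : ∀ a → 15 * (16 * a) ≡ 8 * (15 * (2 * a))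
      l₁ = solve-∀
    go : Tri (A < a) (A ≡ a) (a < A) → CommonBase A B → ⊥
    go (tri≈ _ A≡a _) _ = A≢a A≡a
    go (tri< A<a _ _) (common-base {h} {r} {s} 2≤h 1≤r 1≤s cop′ A≡ B≡) =
      Conclusion.impossible {g} {h} {m} {r} {n} {s} record
        { 2≤e = 2≤g ; 2≤f = 2≤h ; 1≤α = 1≤m ; 1≤β = 1≤r
        ; α<u = m<n ; β<w = exponents< h 2≤h (subst₂ _<_ A≡ B≡ A<B)
        ; Y<X = subst (_< a) A≡ A<a
        ; gap = subst (λ A → 16 * ((a ∸ A) * (a ∸ A)) < a) A≡ (proj₂ closeA)
        ; close = subst (Close b) B≡ closeB ; coprime₁ = cop ; coprime₂ = cop′ }
    -- Now `X` is `A`, so `U` is `B` and `V` is `b`; the two halves of `Close` change places.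
    go (tri> _ _ a<A) (common-base {h} {r} {s} 2≤h 1≤r 1≤s cop′ A≡ B≡) =
      Conclusion.impossible {h} {g} {r} {m} {s} {n} record
        { 2≤e = 2≤h ; 2≤f = 2≤g ; 1≤α = 1≤r ; 1≤β = 1≤m
        ; α<u = exponents< h 2≤h (subst₂ _<_ A≡ B≡ A<B) ; β<w = m<n
        ; Y<X = subst (a <_) A≡ a<A
        ; gap = subst (λ A → 16 * ((A ∸ a) * (A ∸ a)) < A) A≡ (proj₁ closeA)
        ; close = swap (subst (Close b) B≡ closeB) ; coprime₁ = cop′ ; coprime₂ = cop }

open import Data.Integer using (ℤ; +_; _+_; _*_; _<_; ∣_∣)
open import Relation.Binary.PropositionalEquality using (_≡_)
open import Relation.Nullary using (¬_)

open import Algebra.Properties.AbelianGroup using (identityʳ-unique)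
open import Data.Integer.Properties using (+-0-abelianGroup)
open import Data.Nat.Properties using (<-trans)
open import Data.Product using (_,_)
open import Relation.Binary.PropositionalEquality using (refl; subst₂)
open MultiplicativeDependence using (perturb; multDep⇒commonBase; close-powers-independent)

theorem2p2 : (a b : ℤ) → + 1 < a → a < b → MultDep₂ a b →
    (ε δ : ℤ) →
    ¬ (ε ≡ + 0) → (+ 16) * (ε * ε) < a →
    ¬ (δ ≡ + 0) → (+ 16) * (δ * δ) < b →
    MultIndep₂ (a + ε) (b + δ)
theorem2p2 (+ a) (+ b) (_<_.+<+ 1<a) (_<_.+<+ a<b) dep ε δ ε≢0 16ε²<a _ 16δ²<b dep′
  with perturb a ε 16ε²<a | perturb b δ 16δ²<b
... | A , a+ε≡A , closeA | B , b+δ≡B , closeB = close-powers-independent 1<a a<b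
  (multDep⇒commonBase a b 1<a (<-trans 1<a a<b) dep) closeA
  (λ { refl → ε≢0 (identityʳ-unique +-0-abelianGroup (+ a) ε a+ε≡A) }) closeB
  (λ 2≤A 2≤B → multDep⇒commonBase A B 2≤A 2≤B (subst₂ MultDep₂ a+ε≡A b+δ≡B dep′))
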